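{- Let $\kappa$ be a regular uncountable cardinal and $\lambda>\kappa$ a cardinal. Suppose that (a) $\kappa$ is a limit cardinal such that $2^{<\kappa}=\kappa$, and (b) either $\lambda>\overline{\mathfrak d}_\kappa$, or $\overline{\mathfrak d}_\kappa\in\mathcal K(\kappa,\lambda)$. Then it is not the case that $I_{\kappa,\lambda}^+\xrightarrow[\kappa]{\kappa}[I_{\kappa,\lambda}^+]^2_\kappa$.
   Context: For a cardinal $\mu$ and a set $A$, $P_\mu(A)=\{a\subseteq A:|a|<\mu\}$. $I_{\kappa,\lambda}$ is the set of all $A\subseteq P_\kappa(\lambda)$ such that $A\cap\{b\in P_\kappa(\lambda):a\subseteq b\}=\emptyset$ for some $a\in P_\kappa(\lambda)$; $I_{\kappa,\lambda}^+$ is the set of subsets of $P_\kappa(\lambda)$ not in $I_{\kappa,\lambda}$. $\mathcal K(\kappa,\lambda)$ is the set of all cardinals $\sigma\ge\lambda$ for which there is $T\subseteq P_\kappa(\lambda)$ with $|T|=\sigma$ and $|T\cap P(a)|<\kappa$ for every $a\in P_\kappa(\lambda)$. $\overline{\mathfrak d}_\kappa$ is the least cardinality of an $X\subseteq{}^\kappa\kappa$ such that for every $g\in{}^\kappa\kappa$ there is $x\in P_\kappa(X)$ with $g(\alpha)<\bigcup_{f\in x}f(\alpha)$ for all $\alpha<\kappa$. For $A\subseteq P_\kappa(\lambda)$, $[A]^2_{\kappa,\kappa}=\{(\bigcup(a\cap\kappa),\bigcup(b\cap\kappa)):a,b\in A,\ \bigcup(a\cap\kappa)<\bigcup(b\cap\kappa)\}$.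 For a cardinal $\rho\in[2,\kappa]$, $I_{\kappa,\lambda}^+\xrightarrow[\kappa]{\kappa}[I_{\kappa,\lambda}^+]^2_\rho$ means: for every $F:[P_\kappa(\lambda)]^2_{\kappa,\kappa}\to\rho$ and every $A\in I_{\kappa,\lambda}^+$ there is $B\in I_{\kappa,\lambda}^+\cap P(A)$ such that $F''[B]^2_{\kappa,\kappa}\ne\rho$. -}

module Defs where

open import Level using (Level) renaming (suc to lsuc)
open import Data.Product using (Σ; ∃; ∃!; _×_; _,_; proj₁; proj₂)
open import Data.Sum using (_⊎_)
open import Function.Bundles using (_⇔_)
open import Relation.Nullary using (¬_)
open import Relation.Binary.PropositionalEquality using (_≡_; _≢_)

-- A universe of sets satisfying the axioms of ZFC.  The separation and
-- replacement schemes range over arbitrary predicates of the ambient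
-- type theory, in the manner of the usual shallow embeddings of ZF.
record ZFC (ℓ : Level) : Set (lsuc ℓ) where
  infix 4 _∈_
  field
    V   : Set ℓ
    _∈_ : V → V → Set ℓ

  infix 4 _∉_ _⊆_

  _∉_ : V → V → Set ℓ
  x ∉ y = ¬ (x ∈ y)

  _⊆_ : V → V → Set ℓ
  x ⊆ y = ∀ z → z ∈ x → z ∈ y

  IsEmpty : V → Set ℓ
  IsEmpty e = ∀ z → z ∉ e

  IsSuccessor : V → V → Set ℓ
  IsSuccessor x s = ∀ z → z ∈ s ⇔ (z ∈ x ⊎ z ≡ x)

  IsInductive : V → Set ℓ
  IsInductive i = (∀ e → IsEmpty e → e ∈ i)
                × (∀ x s → x ∈ i → IsSuccessor x s → s ∈ i)

  field
    extensionality : ∀ x y → (∀ z → z ∈ x ⇔ z ∈ y) → x ≡ y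
    foundation     : ∀ x → (∃ λ y → y ∈ x) →
                     ∃ λ y → y ∈ x × (∀ z → z ∈ x → z ∉ y)
    pairing        : ∀ x y → ∃ λ p → ∀ z → z ∈ p ⇔ (z ≡ x ⊎ z ≡ y)
    union          : ∀ x → ∃ λ u → ∀ z → z ∈ u ⇔ (∃ λ y → y ∈ x × z ∈ y)
    powerset       : ∀ x → ∃ λ p → ∀ z → z ∈ p ⇔ z ⊆ x
    infinity       : ∃ λ i → IsInductive i
    separation     : (P : V → Set ℓ) → ∀ x →
                     ∃ λ y → ∀ z → z ∈ y ⇔ (z ∈ x × P z)
    replacement    : (R : V → V → Set ℓ) → ∀ x →
                     (∀ y → y ∈ x → ∀ z z′ → R y z → R y z′ → z ≡ z′) →
                     ∃ λ w → ∀ z → z ∈ w ⇔ (∃ λ y → y ∈ x × R y z)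
    choice         : ∀ x →
                     (∀ y → y ∈ x → ∃ λ z → z ∈ y) →
                     (∀ y y′ → y ∈ x → y′ ∈ x → y ≢ y′ → ∀ z → z ∈ y → z ∉ y′) →
                     ∃ λ c → ∀ y → y ∈ x → ∃! _≡_ λ z → z ∈ y × z ∈ c

module Notions {ℓ : Level} (M : ZFC ℓ) where

  open ZFC M

  infixl 7 _∩_
  infixl 6 _∪_
  infix  8 ⋃_
  infixr 7 _⊗_
  infixr 5 _⇒_
  infixl 9 _·_

  sep : V → (V → Set ℓ) → V
  sep A P = proj₁ (separation P A)

  syntax sep A (λ x → P) = ｛ x ∶ A ∣ P ｝

  repl : V → (V → V) → V
  repl A φ = proj₁ (replacement (λ x y → y ≡ φ x) A
                     λ { _ _ _ _ _≡_.refl _≡_.refl → _≡_.refl })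

  syntax repl A (λ x → e) = ｛ e ∥ x ∶ A ｝

  ⟅_,_⟆ : V → V → V
  ⟅ x , y ⟆ = proj₁ (pairing x y)

  ⟨_,_⟩ : V → V → V
  ⟨ x , y ⟩ = ⟅ ⟅ x , x ⟆ , ⟅ x , y ⟆ ⟆

  ⋃_ : V → V
  ⋃ x = proj₁ (union x)

  𝒫 : V → V
  𝒫 x = proj₁ (powerset x)

  _∪_ : V → V → V
  x ∪ y = ⋃ ⟅ x , y ⟆

  _∩_ : V → V → V
  x ∩ y = ｛ z ∶ x ∣ z ∈ y ｝

  _⊗_ : V → V → V
  A ⊗ B = ｛ p ∶ 𝒫 (𝒫 (A ∪ B)) ∣
            (∃ λ x → ∃ λ y → x ∈ A × y ∈ B × p ≡ ⟨ x , y ⟩) ｝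

  -- A ⇒ B is the set of all functions from A to B, also written ᴬB.
  _⇒_ : V → V → V
  A ⇒ B = ｛ f ∶ 𝒫 (A ⊗ B) ∣ (∀ x → x ∈ A → ∃! _≡_ λ y → ⟨ x , y ⟩ ∈ f) ｝

  -- For a Kuratowski pair, both components of any ⟨ x , y ⟩ ∈ f lie in ⋃ ⋃ f.
  image : V → V → V
  image f A = ｛ y ∶ ⋃ ⋃ f ∣ (∃ λ x → x ∈ A × ⟨ x , y ⟩ ∈ f) ｝

  -- The union strips the singleton: for a function f with x in its domain,
  -- image f {x} = {f(x)}.
  _·_ : V → V → V
  f · x = ⋃ image f ⟅ x , x ⟆

  ∅ : V
  ∅ = ｛ x ∶ proj₁ infinity ∣ x ≢ x ｝

  succ : V → V
  succ x = x ∪ ⟅ x , x ⟆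

  two : V
  two = succ (succ ∅)

  ω : V
  ω = ｛ n ∶ proj₁ infinity ∣ (∀ i → IsInductive i → n ∈ i) ｝

  -- For ordinals and cardinals, < is rendered by ∈ and ≤ by ⊆.

  -- Well-foundedness of ∈ is supplied by the axiom of foundation.
  IsOrdinal : V → Set ℓ
  IsOrdinal α = (∀ β → β ∈ α → β ⊆ α)
              × (∀ β γ → β ∈ α → γ ∈ α → β ∈ γ ⊎ β ≡ γ ⊎ γ ∈ β)

  IsBijection : V → V → V → Set ℓ
  IsBijection f A B = f ∈ (A ⇒ B)
                    × (∀ x x′ → x ∈ A → x′ ∈ A → f · x ≡ f · x′ → x ≡ x′)
                    × (∀ y → y ∈ B → ∃ λ x → x ∈ A × f · x ≡ y)

  infix 4 _≈_
  _≈_ : V → V → Set ℓ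
  A ≈ B = ∃ λ f → IsBijection f A B

  IsCardinal : V → Set ℓ
  IsCardinal κ = IsOrdinal κ × (∀ α → α ∈ κ → ¬ (α ≈ κ))

  ∣_∣≡_ : V → V → Set ℓ
  ∣ A ∣≡ σ = IsCardinal σ × A ≈ σ

  ∣_∣<_ : V → V → Set ℓ
  ∣ A ∣< μ = ∃ λ σ → ∣ A ∣≡ σ × σ ∈ μ

  IsLeastOrdinal : (V → Set ℓ) → V → Set ℓ
  IsLeastOrdinal P α = IsOrdinal α × P α × (∀ β → IsOrdinal β → P β → α ⊆ β)

  -- cf(κ) = μ, for a limit ordinal κ
  HasCofinality : V → V → Set ℓ
  HasCofinality κ = IsLeastOrdinal λ σ →
    ∃ λ X → X ⊆ κ × ∣ X ∣≡ σ × (∀ α → α ∈ κ → ∃ λ ξ → ξ ∈ X × α ⊆ ξ)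

  IsRegular : V → Set ℓ
  IsRegular κ = IsCardinal κ × ω ⊆ κ × HasCofinality κ κ

  -- This excludes successor cardinals; 0 is not ruled out, but is never
  -- uncountable.
  IsLimitCardinal : V → Set ℓ
  IsLimitCardinal κ = IsCardinal κ ×
    (∀ μ → IsCardinal μ → μ ∈ κ → ∃ λ ν → IsCardinal ν × μ ∈ ν × ν ∈ κ)

  -- 2^{<κ} = τ, where 2^{<κ} = sup { 2^μ : μ < κ a cardinal }
  TwoToThe<_≡_ : V → V → Set ℓ
  TwoToThe< κ ≡ τ = IsLeastOrdinal
    (λ υ → ∀ μ σ → IsCardinal μ → μ ∈ κ → ∣ μ ⇒ two ∣≡ σ → σ ⊆ υ) τ

  -- Below Λ stands for the cardinal λ, a reserved symbol.

  P : V → V → V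
  P μ A = ｛ a ∶ 𝒫 A ∣ ∣ a ∣< μ ｝

  I : V → V → V
  I κ Λ = ｛ A ∶ 𝒫 (P κ Λ) ∣
            (∃ λ a → a ∈ P κ Λ × A ∩ ｛ b ∶ P κ Λ ∣ a ⊆ b ｝ ≡ ∅) ｝

  I⁺ : V → V → V
  I⁺ κ Λ = ｛ A ∶ 𝒫 (P κ Λ) ∣ A ∉ I κ Λ ｝

  𝒦 : V → V → V → Set ℓ
  𝒦 κ Λ σ = IsCardinal σ × Λ ⊆ σ ×
    (∃ λ T → T ⊆ P κ Λ × ∣ T ∣≡ σ × (∀ a → a ∈ P κ Λ → ∣ T ∩ 𝒫 a ∣< κ))

  -- 𝔡̄ κ ≡ δ, stated as a relation between κ and δ
  IsDBar : V → V → Set ℓ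
  IsDBar κ = IsLeastOrdinal λ σ →
    ∃ λ X → X ⊆ (κ ⇒ κ) × ∣ X ∣≡ σ ×
      (∀ g → g ∈ (κ ⇒ κ) → ∃ λ x → x ∈ P κ X ×
        (∀ α → α ∈ κ → g · α ∈ ⋃ ｛ f · α ∥ f ∶ x ｝))

  -- [ A ]²_{κ,κ}
  Pairs : V → V → V
  Pairs κ A = ｛ p ∶ S ⊗ S ∣
      (∃ λ a → ∃ λ b → a ∈ A × b ∈ A × s a ∈ s b × p ≡ ⟨ s a , s b ⟩) ｝
    where
    s : V → V
    s a = ⋃ (a ∩ κ)
    S : V
    S = ｛ s a ∥ a ∶ A ｝

  -- I⁺_{κ,λ} →^κ_κ [ I⁺_{κ,λ} ]²_ρ
  Arrow : V → V → V → Set ℓ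
  Arrow κ Λ ρ =
    ∀ F → F ∈ (Pairs κ (P κ Λ) ⇒ ρ) →
    ∀ A → A ∈ I⁺ κ Λ →
    ∃ λ B → B ∈ I⁺ κ Λ ∩ 𝒫 A × image F (Pairs κ B) ≢ ρ

module Submission where

open import Defs
open import Axiom.ExcludedMiddle using (ExcludedMiddle)
open import Data.Empty using (⊥; ⊥-elim)
open import Data.Product using (∃; _×_; _,_; proj₁; proj₂)
open import Data.Sum using (_⊎_; inj₁; inj₂; [_,_]′)
open import Function.Base using (_∘_; id; case_of_)
open import Function.Bundles using (_⇔_; mk⇔; Equivalence)
open import Induction.WellFounded using (WellFounded; Acc; acc; module All; module FixPoint)
open import Level using (Level)
open import Relation.Binary.PropositionalEquality using (_≡_; _≢_; refl; sym; trans; cong; cong₂; subst; subst₂)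
open import Relation.Nullary using (¬_; yes; no)
open import Relation.Nullary.Decidable using (decidable-stable; toSum)

-- Since 2^{<κ} = κ, the ordinals γ < κ can code all sequences seq γ of length and
-- height below κ. Say that γ outpaces f : κ → κ if seq γ has length at least f(ω)
-- and each of its terms is below γ and exceeds f at the supremum of the preceding
-- terms. Write s(a) for ⋃(a ∩ κ). Indexing a dominating family of size 𝔡̄_κ by a set T ⊆ P_κ(λ) only
-- few of whose members lie below any given a, let A consist of the a for which
-- s(a) outpaces the function of each t ∈ T with t ⊆ a and s(t) < s(a); then A is
-- cofinal. Colour a pair γ < γ′ by the least i with γ < seq γ′ i. Given a cofinal
-- B ⊆ A and a colour i, let g(α) be some s(a) ≥ max(α, i) with a ∈ B. There is
-- b ∈ B such that γ′ = s(b) outpaces fewer than κ functions whose supremum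
-- dominates g; with ζ the supremum of the terms of seq γ′ before i, the ordinal
-- γ = g(ζ) is at least ζ and below the i-th term, so that (γ, γ′) has colour i.

module SetTheory {ℓ : Level} (em : ExcludedMiddle ℓ) (M : ZFC ℓ) where

  open ZFC M
  open Notions M

  -- Membership rules and Kuratowski pairs.

  byContradiction : {A : Set ℓ} → ¬ ¬ A → A
  byContradiction = decidable-stable em

  ext : ∀ {x y} → x ⊆ y → y ⊆ x → x ≡ y
  ext p q = extensionality _ _ λ z → mk⇔ (p z) (q z)

  ∈sep⁺ : ∀ {Q : V → Set ℓ} {A z} → z ∈ A → Q z → z ∈ sep A Q
  ∈sep⁺ {Q} {A} p q = Equivalence.from (proj₂ (separation Q A) _) (p , q)

  ∈sep⁻ : ∀ {Q : V → Set ℓ} {A z} → z ∈ sep A Q → z ∈ A × Q z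
  ∈sep⁻ {Q} {A} = Equivalence.to (proj₂ (separation Q A) _)

  ∈repl⁺ : ∀ {φ : V → V} {A y} → y ∈ A → φ y ∈ repl A φ
  ∈repl⁺ {φ} {A} p = Equivalence.from (proj₂ (replacement _ A _) _) (_ , p , refl)

  ∈repl⁻ : ∀ {φ : V → V} {A z} → z ∈ repl A φ → ∃ λ y → y ∈ A × z ≡ φ y
  ∈repl⁻ {φ} {A} = Equivalence.to (proj₂ (replacement _ A _) _)

  ∈pair⁻ : ∀ {x y z} → z ∈ ⟅ x , y ⟆ → z ≡ x ⊎ z ≡ y
  ∈pair⁻ = Equivalence.to (proj₂ (pairing _ _) _)

  ∈pairˡ : ∀ {x y} → x ∈ ⟅ x , y ⟆
  ∈pairˡ = Equivalence.from (proj₂ (pairing _ _) _) (inj₁ refl)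

  ∈pairʳ : ∀ {x y} → y ∈ ⟅ x , y ⟆
  ∈pairʳ = Equivalence.from (proj₂ (pairing _ _) _) (inj₂ refl)

  ∈singleton⁻ : ∀ {x z} → z ∈ ⟅ x , x ⟆ → z ≡ x
  ∈singleton⁻ p with ∈pair⁻ p
  ... | inj₁ q = q
  ... | inj₂ q = q

  ∈⋃⁺ : ∀ {x y z} → y ∈ x → z ∈ y → z ∈ ⋃ x
  ∈⋃⁺ p q = Equivalence.from (proj₂ (union _) _) (_ , p , q)

  ∈⋃⁻ : ∀ {x z} → z ∈ ⋃ x → ∃ λ y → y ∈ x × z ∈ y
  ∈⋃⁻ = Equivalence.to (proj₂ (union _) _)

  ∈𝒫⁺ : ∀ {x z} → z ⊆ x → z ∈ 𝒫 x
  ∈𝒫⁺ = Equivalence.from (proj₂ (powerset _) _)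

  ∈𝒫⁻ : ∀ {x z} → z ∈ 𝒫 x → z ⊆ x
  ∈𝒫⁻ = Equivalence.to (proj₂ (powerset _) _)

  ∈∪⁻ : ∀ {x y z} → z ∈ x ∪ y → z ∈ x ⊎ z ∈ y
  ∈∪⁻ p with ∈⋃⁻ p
  ... | w , w∈ , z∈w with ∈pair⁻ w∈
  ... | inj₁ refl = inj₁ z∈w
  ... | inj₂ refl = inj₂ z∈w

  ∈∪ˡ : ∀ {x y z} → z ∈ x → z ∈ x ∪ y
  ∈∪ˡ = ∈⋃⁺ ∈pairˡ

  ∈∪ʳ : ∀ {x y z} → z ∈ y → z ∈ x ∪ y
  ∈∪ʳ = ∈⋃⁺ ∈pairʳ

  ∉∅ : ∀ {z} → z ∉ ∅
  ∉∅ p = proj₂ (∈sep⁻ p) refl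

  singleton-injective : ∀ {x y} → ⟅ x , x ⟆ ≡ ⟅ y , y ⟆ → x ≡ y
  singleton-injective {x} e = ∈singleton⁻ (subst (x ∈_) e ∈pairˡ)

  ⟨,⟩-injectiveˡ : ∀ {x y x′ y′} → ⟨ x , y ⟩ ≡ ⟨ x′ , y′ ⟩ → x ≡ x′
  ⟨,⟩-injectiveˡ {x} {y} {x′} {y′} e with ∈pair⁻ (subst (⟅ x , x ⟆ ∈_) e ∈pairˡ)
  ... | inj₁ q = singleton-injective q
  ... | inj₂ q = sym (∈singleton⁻ (subst (x′ ∈_) (sym q) ∈pairˡ))

  ⟨,⟩-injectiveʳ : ∀ {x y x′ y′} → ⟨ x , y ⟩ ≡ ⟨ x′ , y′ ⟩ → y ≡ y′
  ⟨,⟩-injectiveʳ {x} {y} {x′} {y′} e with ⟨,⟩-injectiveˡ e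
  ... | refl with ∈pair⁻ (subst (⟅ x , y ⟆ ∈_) e ∈pairʳ) | ∈pair⁻ (subst (⟅ x , y′ ⟆ ∈_) (sym e) ∈pairʳ)
  ... | inj₂ q | _ with ∈pair⁻ (subst (y ∈_) q ∈pairʳ) | ∈pair⁻ (subst (y′ ∈_) (sym q) ∈pairʳ)
  ... | inj₂ r | _ = r
  ... | inj₁ r | inj₁ r′ = trans r (sym r′)
  ... | inj₁ r | inj₂ r′ = sym r′
  ⟨,⟩-injectiveʳ {x} {y} {x′} {y′} e | refl | inj₁ q | inj₁ q′ =
    trans (∈singleton⁻ (subst (y ∈_) q ∈pairʳ)) (sym (∈singleton⁻ (subst (y′ ∈_) q′ ∈pairʳ)))
  ⟨,⟩-injectiveʳ {x} {y} {x′} {y′} e | refl | inj₁ q | inj₂ q′ with ∈pair⁻ (subst (y′ ∈_) q′ ∈pairʳ)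
  ... | inj₂ r = sym r
  ... | inj₁ r = trans (∈singleton⁻ (subst (y ∈_) q ∈pairʳ)) (sym r)

  ∈⊗⁺ : ∀ {A B x y} → x ∈ A → y ∈ B → ⟨ x , y ⟩ ∈ A ⊗ B
  ∈⊗⁺ {A} {B} {x} {y} p q = ∈sep⁺ (∈𝒫⁺ λ u u∈ → ∈𝒫⁺ (sub u u∈)) (x , y , p , q , refl)
    where
    sub : ∀ u → u ∈ ⟨ x , y ⟩ → u ⊆ A ∪ B
    sub u u∈ z z∈ with ∈pair⁻ u∈
    ... | inj₁ refl = ∈∪ˡ (subst (_∈ A) (sym (∈singleton⁻ z∈)) p)
    ... | inj₂ refl with ∈pair⁻ z∈
    ... | inj₁ refl = ∈∪ˡ p
    ... | inj₂ refl = ∈∪ʳ q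

  ∈⊗⁻ : ∀ {A B p} → p ∈ A ⊗ B → ∃ λ x → ∃ λ y → x ∈ A × y ∈ B × p ≡ ⟨ x , y ⟩
  ∈⊗⁻ = proj₂ ∘ ∈sep⁻

  ⟨,⟩∈⊗⁻ : ∀ {A B x y} → ⟨ x , y ⟩ ∈ A ⊗ B → x ∈ A × y ∈ B
  ⟨,⟩∈⊗⁻ {A} {B} p with ∈⊗⁻ p
  ... | _ , _ , x∈ , y∈ , e =
    subst (_∈ A) (sym (⟨,⟩-injectiveˡ e)) x∈ , subst (_∈ B) (sym (⟨,⟩-injectiveʳ e)) y∈

  opaque
    -- Decidability of existence statements is global choice; the junk value is ∅.
    ε : (V → Set ℓ) → V
    ε Q with em {∃ Q}
    ... | yes (x , _) = x
    ... | no _ = ∅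

    ε-spec : (Q : V → Set ℓ) → ∃ Q → Q (ε Q)
    ε-spec Q p with em {∃ Q}
    ... | yes (_ , q) = q
    ... | no ¬p = ⊥-elim (¬p p)

    if_then_else_ : Set ℓ → V → V → V
    if A then x else y with em {A}
    ... | yes _ = x
    ... | no _ = y

    if-yes : ∀ {A x y} → A → (if A then x else y) ≡ x
    if-yes {A} a with em {A}
    ... | yes _ = refl
    ... | no ¬a = ⊥-elim (¬a a)

    if-no : ∀ {A x y} → ¬ A → (if A then x else y) ≡ y
    if-no {A} ¬a with em {A}
    ... | yes a = ⊥-elim (¬a a)
    ... | no _ = refl

  opaque
    fst : V → V
    fst p = ε λ x → ∃ λ y → p ≡ ⟨ x , y ⟩

    snd : V → V
    snd p = ε λ y → ∃ λ x → p ≡ ⟨ x , y ⟩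

    fst-⟨,⟩ : ∀ x y → fst ⟨ x , y ⟩ ≡ x
    fst-⟨,⟩ x y = sym (⟨,⟩-injectiveˡ (proj₂ (ε-spec (λ x′ → ∃ λ y′ → ⟨ x , y ⟩ ≡ ⟨ x′ , y′ ⟩) (x , y , refl))))

    snd-⟨,⟩ : ∀ x y → snd ⟨ x , y ⟩ ≡ y
    snd-⟨,⟩ x y = sym (⟨,⟩-injectiveʳ (proj₂ (ε-spec (λ y′ → ∃ λ x′ → ⟨ x , y ⟩ ≡ ⟨ x′ , y′ ⟩) (y , x , refl))))

  -- Functions as sets of pairs.

  ⇒-⊗ : ∀ {A B f p} → f ∈ (A ⇒ B) → p ∈ f → p ∈ A ⊗ B
  ⇒-⊗ f∈ = ∈𝒫⁻ (proj₁ (∈sep⁻ f∈)) _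

  ∈image⁺ : ∀ {f X x y} → x ∈ X → ⟨ x , y ⟩ ∈ f → y ∈ image f X
  ∈image⁺ x∈ p = ∈sep⁺ (∈⋃⁺ (∈⋃⁺ p ∈pairʳ) ∈pairʳ) (_ , x∈ , p)

  ∈image⁻ : ∀ {f X y} → y ∈ image f X → ∃ λ x → x ∈ X × ⟨ x , y ⟩ ∈ f
  ∈image⁻ = proj₂ ∘ ∈sep⁻

  ·-unique : ∀ {A B f x y} → f ∈ (A ⇒ B) → ⟨ x , y ⟩ ∈ f → f · x ≡ y
  ·-unique {A} {B} {f} {x} {y} f∈ p = ext to from
    where
    value : ∀ {y′} → y′ ∈ image f ⟅ x , x ⟆ → y′ ≡ y
    value q with ∈image⁻ q
    ... | x′ , x′∈ , r with ∈singleton⁻ x′∈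
    ... | refl with proj₂ (∈sep⁻ f∈) x (proj₁ (⟨,⟩∈⊗⁻ (⇒-⊗ f∈ p)))
    ... | _ , _ , unique = trans (sym (unique r)) (unique p)
    to : f · x ⊆ y
    to z z∈ with ∈⋃⁻ z∈
    ... | w , w∈ , z∈w with value w∈
    ... | refl = z∈w
    from : y ⊆ f · x
    from z z∈ = ∈⋃⁺ (∈image⁺ ∈pairˡ p) z∈

  ·-graph : ∀ {A B f x} → f ∈ (A ⇒ B) → x ∈ A → ⟨ x , f · x ⟩ ∈ f
  ·-graph {f = f} {x} f∈ x∈ with proj₂ (∈sep⁻ f∈) x x∈
  ... | y , p , _ = subst (λ y → ⟨ x , y ⟩ ∈ f) (sym (·-unique f∈ p)) p

  ·-∈ : ∀ {A B f x} → f ∈ (A ⇒ B) → x ∈ A → f · x ∈ B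
  ·-∈ f∈ x∈ = proj₂ (⟨,⟩∈⊗⁻ (⇒-⊗ f∈ (·-graph f∈ x∈)))

  graph : V → (V → V) → V
  graph A φ = ｛ ⟨ x , φ x ⟩ ∥ x ∶ A ｝

  graph-⇒ : ∀ {A B φ} → (∀ {x} → x ∈ A → φ x ∈ B) → graph A φ ∈ (A ⇒ B)
  graph-⇒ {A} {B} {φ} φ∈ = ∈sep⁺ (∈𝒫⁺ sub) λ x x∈ → φ x , ∈repl⁺ x∈ , λ {_} → unique
    where
    sub : graph A φ ⊆ A ⊗ B
    sub p p∈ with ∈repl⁻ p∈
    ... | x , x∈ , refl = ∈⊗⁺ x∈ (φ∈ x∈)
    unique : ∀ {x y} → ⟨ x , y ⟩ ∈ graph A φ → φ x ≡ y
    unique p with ∈repl⁻ p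
    ... | x′ , _ , e with ⟨,⟩-injectiveˡ e | ⟨,⟩-injectiveʳ e
    ... | refl | refl = refl

  graph-· : ∀ {A B φ x} → (∀ {x} → x ∈ A → φ x ∈ B) → x ∈ A → graph A φ · x ≡ φ x
  graph-· φ∈ x∈ = ·-unique (graph-⇒ φ∈) (∈repl⁺ x∈)

  -- Class bijections; they compose without any coding of functions as sets.
  infix 4 _≃_
  record _≃_ (A B : V) : Set ℓ where
    field
      to      : V → V
      from    : V → V
      to-∈    : ∀ {x} → x ∈ A → to x ∈ B
      from-∈  : ∀ {y} → y ∈ B → from y ∈ A
      from-to : ∀ {x} → x ∈ A → from (to x) ≡ x
      to-from : ∀ {y} → y ∈ B → to (from y) ≡ y
  open _≃_

  ≃-sym : ∀ {A B} → A ≃ B → B ≃ A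
  ≃-sym e = record { to = from e ; from = to e ; to-∈ = from-∈ e ; from-∈ = to-∈ e
                   ; from-to = to-from e ; to-from = from-to e }

  ≃-trans : ∀ {A B C} → A ≃ B → B ≃ C → A ≃ C
  ≃-trans e f = record
    { to      = to f ∘ to e
    ; from    = from e ∘ from f
    ; to-∈    = to-∈ f ∘ to-∈ e
    ; from-∈  = from-∈ e ∘ from-∈ f
    ; from-to = λ x∈ → trans (cong (from e) (from-to f (to-∈ e x∈))) (from-to e x∈)
    ; to-from = λ y∈ → trans (cong (to f) (to-from e (from-∈ f y∈))) (to-from f y∈)
    }

  injection-≃ : ∀ {A B} (φ : V → V) → (∀ {x} → x ∈ A → φ x ∈ B) →
                (∀ {x x′} → x ∈ A → x′ ∈ A → φ x ≡ φ x′ → x ≡ x′) →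
                (∀ {y} → y ∈ B → ∃ λ x → x ∈ A × φ x ≡ y) → A ≃ B
  injection-≃ {A} φ φ∈ φ-inj φ-surj = record
    { to      = φ
    ; from    = ψ
    ; to-∈    = φ∈
    ; from-∈  = proj₁ ∘ ψ-preimage ∘ φ-surj
    ; from-to = λ x∈ → let (ψ∈ , e) = ψ-preimage (_ , x∈ , refl) in φ-inj ψ∈ x∈ e
    ; to-from = proj₂ ∘ ψ-preimage ∘ φ-surj
    }
    where
    ψ : V → V
    ψ y = ε λ x → x ∈ A × φ x ≡ y
    ψ-preimage : ∀ {y} → (∃ λ x → x ∈ A × φ x ≡ y) → ψ y ∈ A × φ (ψ y) ≡ y
    ψ-preimage {y} = ε-spec (λ x → x ∈ A × φ x ≡ y)

  ≈⇒≃ : ∀ {A B} → A ≈ B → A ≃ B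
  ≈⇒≃ (f , f∈ , f-inj , f-surj) = injection-≃ (f ·_) (·-∈ f∈) (f-inj _ _) (f-surj _)

  ≃⇒≈ : ∀ {A B} → A ≃ B → A ≈ B
  ≃⇒≈ {A} {B} e = graph A (to e) , graph-⇒ (to-∈ e) , inj , surj
    where
    value : ∀ {x} → x ∈ A → graph A (to e) · x ≡ to e x
    value = graph-· (to-∈ e)
    inj : ∀ x x′ → x ∈ A → x′ ∈ A → graph A (to e) · x ≡ graph A (to e) · x′ → x ≡ x′
    inj x x′ x∈ x′∈ q = trans (sym (from-to e x∈))
      (trans (cong (from e) (trans (sym (value x∈)) (trans q (value x′∈)))) (from-to e x′∈))
    surj : ∀ y → y ∈ B → ∃ λ x → x ∈ A × graph A (to e) · x ≡ y
    surj y y∈ = from e y , from-∈ e y∈ , trans (value (from-∈ e y∈)) (to-from e y∈)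

  -- Foundation and ordinals.

  ∉-self : ∀ {x} → x ∉ x
  ∉-self {x} p with foundation ⟅ x , x ⟆ (x , ∈pairˡ)
  ... | y , y∈ , min with ∈singleton⁻ y∈
  ... | refl = min x ∈pairˡ p

  ∉-2cycle : ∀ {x y} → x ∈ y → y ∉ x
  ∉-2cycle {x} {y} p q with foundation ⟅ x , y ⟆ (x , ∈pairˡ)
  ... | w , w∈ , min with ∈pair⁻ w∈
  ... | inj₁ refl = min y ∈pairʳ q
  ... | inj₂ refl = min x ∈pairˡ p

  ∉-3cycle : ∀ {x y z} → x ∈ y → y ∈ z → z ∉ x
  ∉-3cycle {x} {y} {z} p q r with foundation (⟅ x , y ⟆ ∪ ⟅ z , z ⟆) (x , ∈∪ˡ ∈pairˡ)
  ... | w , w∈ , min with ∈∪⁻ w∈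
  ... | inj₂ w∈′ with ∈singleton⁻ w∈′
  ... | refl = min y (∈∪ˡ ∈pairʳ) q
  ∉-3cycle {x} {y} {z} p q r | w , w∈ , min | inj₁ w∈′ with ∈pair⁻ w∈′
  ... | inj₁ refl = min z (∈∪ʳ ∈pairˡ) r
  ... | inj₂ refl = min x (∈∪ˡ ∈pairˡ) p

  opaque
    minimal : V → V
    minimal x = ε λ y → y ∈ x × (∀ z → z ∈ x → z ∉ y)

    minimal-∈ : ∀ {x y} → y ∈ x → minimal x ∈ x
    minimal-∈ y∈ = proj₁ (ε-spec (λ m → m ∈ _ × (∀ z → z ∈ _ → z ∉ m)) (foundation _ (_ , y∈)))

    minimal-min : ∀ {x y} → y ∈ x → y ∉ minimal x
    minimal-min y∈ = proj₂ (ε-spec (λ m → m ∈ _ × (∀ z → z ∈ _ → z ∉ m)) (foundation _ (_ , y∈))) _ y∈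

  ordinal-trans : ∀ {α β γ} → IsOrdinal α → β ∈ α → γ ∈ β → γ ∈ α
  ordinal-trans oα p q = proj₁ oα _ p _ q

  -- Trichotomy inside `α` leaves three cases, two of which are excluded because `∈` has no cycles
  -- of length 2 or 3.
  ∈-ordinal : ∀ {α β} → IsOrdinal α → β ∈ α → IsOrdinal β
  ∈-ordinal {α} {β} oα β∈ = transitive , λ γ δ p q → proj₂ oα γ δ (ordinal-trans oα β∈ p) (ordinal-trans oα β∈ q)
    where
    transitive : ∀ γ → γ ∈ β → γ ⊆ β
    transitive γ γ∈ δ δ∈ with proj₂ oα δ β (ordinal-trans oα (ordinal-trans oα β∈ γ∈) δ∈) β∈
    ... | inj₁ p = p
    ... | inj₂ (inj₁ refl) = ⊥-elim (∉-2cycle δ∈ γ∈)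
    ... | inj₂ (inj₂ p) = ⊥-elim (∉-3cycle γ∈ p δ∈)

  -- The minimal element of `β` outside `α` turns out to be `α` itself.
  ⊆-≢⇒∈ : ∀ {α β} → IsOrdinal α → IsOrdinal β → α ⊆ β → α ≢ β → α ∈ β
  ⊆-≢⇒∈ {α} {β} oα oβ α⊆β α≢β = subst (_∈ β) γ≡α γ∈β
    where
    D : V
    D = ｛ z ∶ β ∣ z ∉ α ｝
    nonempty : ∃ λ z → z ∈ D
    nonempty = byContradiction λ ¬p → α≢β (ext α⊆β λ z z∈ → byContradiction λ z∉ → ¬p (z , ∈sep⁺ z∈ z∉))
    γ : V
    γ = minimal D
    γ∈D : γ ∈ D
    γ∈D = minimal-∈ (proj₂ nonempty)
    γ∈β : γ ∈ β
    γ∈β = proj₁ (∈sep⁻ γ∈D)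
    γ∉α : γ ∉ α
    γ∉α = proj₂ (∈sep⁻ γ∈D)
    γ≡α : γ ≡ α
    γ≡α = ext
      (λ z z∈ → byContradiction λ z∉ → minimal-min (∈sep⁺ (ordinal-trans oβ γ∈β z∈) z∉) z∈)
      (λ z z∈ → case proj₂ oβ z γ (α⊆β z z∈) γ∈β of λ
        { (inj₁ p) → p
        ; (inj₂ (inj₁ refl)) → ⊥-elim (γ∉α z∈)
        ; (inj₂ (inj₂ p)) → ⊥-elim (γ∉α (ordinal-trans oα z∈ p)) })

  -- If `α ∩ β` were a proper part of both, it would be an ordinal belonging to both, hence to
  -- itself.
  ordinal-⊆⊎∋ : ∀ {α β} → IsOrdinal α → IsOrdinal β → α ⊆ β ⊎ β ∈ α
  ordinal-⊆⊎∋ {α} {β} oα oβ with em {α ∩ β ≡ α} | em {α ∩ β ≡ β}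
  ... | yes e | _ = inj₁ λ z z∈ → proj₂ (∈sep⁻ (subst (z ∈_) (sym e) z∈))
  ... | no ¬e | yes e = inj₂ (subst (_∈ α) e (⊆-≢⇒∈ (subst IsOrdinal (sym e) oβ) oα (λ z → proj₁ ∘ ∈sep⁻) ¬e))
  ... | no ¬e | no ¬e′ = ⊥-elim (∉-self (∈sep⁺ (⊆-≢⇒∈ o∩ oα (λ z → proj₁ ∘ ∈sep⁻) ¬e)
                                                (⊆-≢⇒∈ o∩ oβ (λ z → proj₂ ∘ ∈sep⁻) ¬e′)))
    where
    o∩ : IsOrdinal (α ∩ β)
    o∩ = (λ γ γ∈ δ δ∈ → let (p , q) = ∈sep⁻ γ∈ in ∈sep⁺ (ordinal-trans oα p δ∈) (ordinal-trans oβ q δ∈))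
       , (λ γ δ p q → proj₂ oα γ δ (proj₁ (∈sep⁻ p)) (proj₁ (∈sep⁻ q)))

  trichotomy : ∀ {α β} → IsOrdinal α → IsOrdinal β → α ∈ β ⊎ α ≡ β ⊎ β ∈ α
  trichotomy {α} {β} oα oβ with ordinal-⊆⊎∋ oα oβ
  ... | inj₂ p = inj₂ (inj₂ p)
  ... | inj₁ p with em {α ≡ β}
  ... | yes e = inj₂ (inj₁ e)
  ... | no ¬e = inj₁ (⊆-≢⇒∈ oα oβ p ¬e)

  ∉⇒⊇ : ∀ {α β} → IsOrdinal α → IsOrdinal β → α ∉ β → β ⊆ α
  ∉⇒⊇ oα oβ p with ordinal-⊆⊎∋ oβ oα
  ... | inj₁ q = q
  ... | inj₂ q = ⊥-elim (p q)

  ⊆-∈⇒∈ : ∀ {α β γ} → IsOrdinal α → IsOrdinal γ → α ⊆ β → β ∈ γ → α ∈ γ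
  ⊆-∈⇒∈ oα oγ p q with ordinal-⊆⊎∋ oγ oα
  ... | inj₁ r = ⊥-elim (∉-self (p _ (r _ q)))
  ... | inj₂ r = r

  ordinals-ordinal : ∀ {A} → (∀ {α} → α ∈ A → IsOrdinal α) → (∀ {α β} → α ∈ A → β ∈ α → β ∈ A) → IsOrdinal A
  ordinals-ordinal o t = (λ β p γ q → t p q) , (λ β γ p q → trichotomy (o p) (o q))

  ⋃-ordinal : ∀ {A} → (∀ {α} → α ∈ A → IsOrdinal α) → IsOrdinal (⋃ A)
  ⋃-ordinal o = ordinals-ordinal
    (λ p → let (_ , a , b) = ∈⋃⁻ p in ∈-ordinal (o a) b)
    (λ p q → let (_ , a , b) = ∈⋃⁻ p in ∈⋃⁺ a (ordinal-trans (o a) b q))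

  -- Induction and recursion on ordinals.

  infix 4 _≺_
  _≺_ : V → V → Set ℓ
  β ≺ α = β ∈ α × IsOrdinal α

  -- Foundation yields a minimal inaccessible element of `α`; since `α` is an ordinal, its
  -- predecessors are again elements of `α`, so they are accessible.
  ≺-wellFounded : WellFounded _≺_
  ≺-wellFounded α = acc λ { {β} (β∈ , oα) → byContradiction λ ¬acc →
    let D = ｛ γ ∶ α ∣ ¬ Acc _≺_ γ ｝
        m∈D = minimal-∈ (∈sep⁺ {λ γ → ¬ Acc _≺_ γ} β∈ ¬acc)
        (m∈α , ¬acc-m) = ∈sep⁻ m∈D
    in ¬acc-m (acc λ { {γ} (γ∈ , _) → byContradiction λ ¬acc-γ →
         minimal-min (∈sep⁺ (ordinal-trans oα m∈α γ∈) ¬acc-γ) γ∈ }) }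

  ordinal-induction : (Q : V → Set ℓ) → (∀ {α} → IsOrdinal α → (∀ {β} → β ∈ α → Q β) → Q α) →
                      ∀ {α} → IsOrdinal α → Q α
  ordinal-induction Q step {α} = All.wfRec ≺-wellFounded ℓ (λ α → IsOrdinal α → Q α)
    (λ α IH oα → step oα λ β∈ → IH (β∈ , oα) (∈-ordinal oα β∈)) α

  repl-cong : ∀ {A φ ψ} → (∀ {x} → x ∈ A → φ x ≡ ψ x) → repl A φ ≡ repl A ψ
  repl-cong {A} {φ} {ψ} e = ext to′ from′
    where
    to′ : repl A φ ⊆ repl A ψ
    to′ z z∈ with ∈repl⁻ z∈
    ... | x , x∈ , refl = subst (_∈ repl A ψ) (sym (e x∈)) (∈repl⁺ x∈)
    from′ : repl A ψ ⊆ repl A φ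
    from′ z z∈ with ∈repl⁻ z∈
    ... | x , x∈ , refl = subst (_∈ repl A φ) (e x∈) (∈repl⁺ x∈)

  ∅∈two : ∅ ∈ two
  ∅∈two = ∈∪ˡ (∈∪ʳ ∈pairˡ)

  one∈two : succ ∅ ∈ two
  one∈two = ∈∪ʳ ∈pairˡ

  -- `H` receives only the set of earlier values, not their order. This suffices both for exhausting
  -- a set and for iterating suprema.
  module OrdinalRecursion (H : V → V) where

    -- Replacement needs a total operation on `V`, so the recursive call is completed by the default
    -- `∅`.
    extend : ∀ α → (∀ {β} → β ≺ α → V) → V → V
    extend α IH β with em {β ≺ α}
    ... | yes p = IH p
    ... | no _ = ∅

    extend-cong : ∀ α {IH IH′ : ∀ {β} → β ≺ α → V} → (∀ {β} (p : β ≺ α) → IH p ≡ IH′ p) →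
                  ∀ β → extend α IH β ≡ extend α IH′ β
    extend-cong α e β with em {β ≺ α}
    ... | yes p = e p
    ... | no _ = refl

    extend-const : ∀ {α β} (φ : V → V) → β ≺ α → extend α (λ {β} _ → φ β) β ≡ φ β
    extend-const {α} {β} φ p with em {β ≺ α}
    ... | yes _ = refl
    ... | no ¬p = ⊥-elim (¬p p)

    step : ∀ α → (∀ {β} → β ≺ α → V) → V
    step α IH = H (repl α (extend α IH))

    step-ext : ∀ α {IH IH′ : ∀ {β} → β ≺ α → V} → (∀ {β} (p : β ≺ α) → IH p ≡ IH′ p) →
               step α IH ≡ step α IH′
    step-ext α e = cong H (repl-cong λ _ → extend-cong α e _)

    module F = FixPoint ≺-wellFounded (λ _ → V) step step-ext

    opaque
      G : V → V
      G = All.wfRec ≺-wellFounded ℓ (λ _ → V) step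

      unfold : ∀ {α} → IsOrdinal α → G α ≡ H (repl α G)
      unfold oα = trans F.unfold-wfRec (cong H (repl-cong λ β∈ → extend-const G (β∈ , oα)))

  -- Exhausts A transfinitely, always taking a remaining element of ∈-minimal rank.
  module Enumeration (A : V) (rk : V → V) where

    pick : V → V
    pick y = minimal ｛ z ∶ y ∣ rk z ≡ minimal ｛ rk z ∥ z ∶ y ｝ ｝

    pick-∈′ : ∀ {y z} → z ∈ y → pick y ∈ ｛ z ∶ y ∣ rk z ≡ minimal ｛ rk z ∥ z ∶ y ｝ ｝
    pick-∈′ {y} z∈ with ∈repl⁻ (minimal-∈ (∈repl⁺ {φ = rk} z∈))
    ... | w , w∈ , e = minimal-∈ (∈sep⁺ {λ z → rk z ≡ minimal ｛ rk z ∥ z ∶ y ｝} w∈ (sym e))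

    pick-∈ : ∀ {y z} → z ∈ y → pick y ∈ y
    pick-∈ z∈ = proj₁ (∈sep⁻ (pick-∈′ z∈))

    pick-min : ∀ {y z} → z ∈ y → rk z ∉ rk (pick y)
    pick-min {y} {z} z∈ p = minimal-min (∈repl⁺ z∈) (subst (rk z ∈_) (proj₂ (∈sep⁻ (pick-∈′ z∈))) p)

    rest : V → V
    rest s = ｛ z ∶ A ∣ z ∉ s ｝

    open OrdinalRecursion (pick ∘ rest) public using (G; unfold)

    Rem : V → V
    Rem ξ = rest (repl ξ G)

    Rem-antitone : ∀ {ξ η} → ξ ⊆ η → Rem η ⊆ Rem ξ
    Rem-antitone {ξ} ξ⊆η z z∈ = ∈sep⁺ (proj₁ (∈sep⁻ z∈)) λ z∈G → case ∈repl⁻ z∈G of λ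
      { (β , β∈ , refl) → proj₂ (∈sep⁻ z∈) (∈repl⁺ (ξ⊆η β β∈)) }

    Active : V → Set ℓ
    Active ξ = IsOrdinal ξ × ∃ λ z → z ∈ Rem ξ

    G-∈Rem : ∀ {ξ} → Active ξ → G ξ ∈ Rem ξ
    G-∈Rem {ξ} (oξ , _ , z∈) = subst (_∈ Rem ξ) (sym (unfold oξ)) (pick-∈ z∈)

    G-min : ∀ {ξ z} → IsOrdinal ξ → z ∈ Rem ξ → rk z ∉ rk (G ξ)
    G-min {ξ} {z} oξ z∈ = subst (λ g → rk z ∉ rk g) (sym (unfold oξ)) (pick-min z∈)

    G-≢ : ∀ {ξ η} → Active η → ξ ∈ η → G ξ ≢ G η
    G-≢ {ξ} {η} aη ξ∈ e = proj₂ (∈sep⁻ (G-∈Rem aη)) (subst (_∈ repl η G) e (∈repl⁺ ξ∈))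

    G-injective′ : ∀ {ξ η} → Active ξ → Active η → G ξ ≡ G η → ξ ≡ η
    G-injective′ aξ aη e with trichotomy (proj₁ aξ) (proj₁ aη)
    ... | inj₁ p = ⊥-elim (G-≢ aη p e)
    ... | inj₂ (inj₁ p) = p
    ... | inj₂ (inj₂ p) = ⊥-elim (G-≢ aξ p (sym e))

    -- Were the enumeration never to end, ρ would be the set of all ordinals.
    ρ-def : ∃ λ w → ∀ ξ → ξ ∈ w ⇔ (∃ λ z → z ∈ A × (Active ξ × G ξ ≡ z))
    ρ-def = replacement (λ z ξ → Active ξ × G ξ ≡ z) A
      λ { z _ ξ η (aξ , e) (aη , e′) → G-injective′ aξ aη (trans e (sym e′)) }

    ρ : V
    ρ = proj₁ ρ-def

    ∈ρ⁻ : ∀ {ξ} → ξ ∈ ρ → Active ξ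
    ∈ρ⁻ p with Equivalence.to (proj₂ ρ-def _) p
    ... | _ , _ , a , _ = a

    ∈ρ⁺ : ∀ {ξ} → Active ξ → ξ ∈ ρ
    ∈ρ⁺ a = Equivalence.from (proj₂ ρ-def _) (_ , proj₁ (∈sep⁻ (G-∈Rem a)) , a , refl)

    ρ-ordinal : IsOrdinal ρ
    ρ-ordinal = ordinals-ordinal (proj₁ ∘ ∈ρ⁻) λ ξ∈ η∈ →
      let (oξ , z , z∈) = ∈ρ⁻ ξ∈ in ∈ρ⁺ (∈-ordinal oξ η∈ , z , Rem-antitone (proj₁ oξ _ η∈) z z∈)

    G-∈ : ∀ {ξ} → ξ ∈ ρ → G ξ ∈ A
    G-∈ = proj₁ ∘ ∈sep⁻ ∘ G-∈Rem ∘ ∈ρ⁻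

    G-injective : ∀ {ξ η} → ξ ∈ ρ → η ∈ ρ → G ξ ≡ G η → ξ ≡ η
    G-injective p q = G-injective′ (∈ρ⁻ p) (∈ρ⁻ q)

    G-surjective : ∀ {z} → z ∈ A → ∃ λ ξ → ξ ∈ ρ × G ξ ≡ z
    G-surjective {z} z∈ with em {z ∈ repl ρ G}
    ... | yes p = let (ξ , ξ∈ , e) = ∈repl⁻ p in ξ , ξ∈ , sym e
    -- An element never enumerated would keep `ρ` itself active, giving `ρ ∈ ρ`.
    ... | no ¬p = ⊥-elim (∉-self (∈ρ⁺ (ρ-ordinal , z , ∈sep⁺ z∈ ¬p)))

    ρ≃A : ρ ≃ A
    ρ≃A = injection-≃ G G-∈ G-injective G-surjective

    -- The element taken at `η` was still available at `ξ`, where one of minimal rank was chosen.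
    rk-G-monotone : ∀ {ξ η} → ξ ∈ η → η ∈ ρ → rk (G η) ∉ rk (G ξ)
    rk-G-monotone {ξ} {η} ξ∈ η∈ =
      let oη = proj₁ (∈ρ⁻ η∈) in
      G-min (∈-ordinal oη ξ∈) (Rem-antitone (proj₁ oη _ ξ∈) _ (G-∈Rem (∈ρ⁻ η∈)))

  -- With the identity as rank, `A` is enumerated in increasing order. Hence `ξ ⊆ G ξ` by induction,
  -- and the order type cannot exceed `α`.
  subset-of-ordinal : ∀ {A α} → IsOrdinal α → A ⊆ α → ∃ λ ρ → IsOrdinal ρ × ρ ⊆ α × ρ ≃ A
  subset-of-ordinal {A} {α} oα A⊆α = E.ρ , E.ρ-ordinal , sub , E.ρ≃A
    where
    module E = Enumeration A id
    oG : ∀ {ξ} → ξ ∈ E.ρ → IsOrdinal (E.G ξ)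
    oG ξ∈ = ∈-ordinal oα (A⊆α _ (E.G-∈ ξ∈))
    inflationary : ∀ {ξ} → IsOrdinal ξ → ξ ∈ E.ρ → ξ ⊆ E.G ξ
    inflationary = ordinal-induction (λ ξ → ξ ∈ E.ρ → ξ ⊆ E.G ξ) λ {ξ} oξ IH ξ∈ β β∈ →
      let β∈ρ = ordinal-trans E.ρ-ordinal ξ∈ β∈
          Gβ∈Gξ = ⊆-≢⇒∈ (oG β∈ρ) (oG ξ∈) (∉⇒⊇ (oG ξ∈) (oG β∈ρ) (E.rk-G-monotone β∈ ξ∈)) (E.G-≢ (E.∈ρ⁻ ξ∈) β∈)
      in ⊆-∈⇒∈ (∈-ordinal oξ β∈) (oG ξ∈) (IH β∈ β∈ρ) Gβ∈Gξ
    sub : E.ρ ⊆ α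
    sub ξ ξ∈ = let oξ = ∈-ordinal E.ρ-ordinal ξ∈ in
      ⊆-∈⇒∈ oξ oα (inflationary oξ ξ∈) (A⊆α _ (E.G-∈ ξ∈))

  -- Cardinalities.

  ∈-succ⁻ : ∀ {x z} → z ∈ succ x → z ∈ x ⊎ z ≡ x
  ∈-succ⁻ p with ∈∪⁻ p
  ... | inj₁ q = inj₁ q
  ... | inj₂ q = inj₂ (∈singleton⁻ q)

  opaque
    cardinality : ∀ A → ∃ λ σ → IsCardinal σ × σ ≃ A
    cardinality A = σ , (oσ , λ α α∈ α≈ →
        minimal-min (∈sep⁺ (∈succρ (proj₁ (∈sep⁻ σ∈)) α∈) (≃-trans (≈⇒≃ α≈) σ≃A)) α∈) , σ≃A
      where
      module E = Enumeration A id
      σ : V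
      -- Searching `succ ρ` rather than `ρ` makes `ρ` itself a candidate, so the search succeeds.
      σ = minimal ｛ σ ∶ succ E.ρ ∣ σ ≃ A ｝
      σ∈ : σ ∈ ｛ σ ∶ succ E.ρ ∣ σ ≃ A ｝
      σ∈ = minimal-∈ (∈sep⁺ {λ σ → σ ≃ A} (∈∪ʳ ∈pairˡ) E.ρ≃A)
      σ≃A : σ ≃ A
      σ≃A = proj₂ (∈sep⁻ σ∈)
      ∈succρ : ∀ {σ τ} → σ ∈ succ E.ρ → τ ∈ σ → τ ∈ succ E.ρ
      ∈succρ {τ = τ} p q = ∈∪ˡ (case ∈-succ⁻ p of λ
        { (inj₁ r) → ordinal-trans E.ρ-ordinal r q ; (inj₂ e) → subst (τ ∈_) e q })
      oσ : IsOrdinal σ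
      oσ = case ∈-succ⁻ (proj₁ (∈sep⁻ σ∈)) of λ
        { (inj₁ r) → ∈-ordinal E.ρ-ordinal r ; (inj₂ e) → subst IsOrdinal (sym e) E.ρ-ordinal }

  card : V → V
  card A = proj₁ (cardinality A)

  card-cardinal : ∀ A → IsCardinal (card A)
  card-cardinal A = proj₁ (proj₂ (cardinality A))

  card-ordinal : ∀ A → IsOrdinal (card A)
  card-ordinal A = proj₁ (card-cardinal A)

  card≃ : ∀ A → card A ≃ A
  card≃ A = proj₂ (proj₂ (cardinality A))

  ∣∣≡card : ∀ A → ∣ A ∣≡ card A
  ∣∣≡card A = card-cardinal A , ≃⇒≈ (≃-sym (card≃ A))

  -- Values outside `A` are allowed, so a covering need not be trimmed to a surjection onto `A`.
  Covers : (V → V) → V → V → Set ℓ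
  Covers φ α A = ∀ {z} → z ∈ A → ∃ λ β → β ∈ α × φ β ≡ z

  -- Choosing preimages makes `A` equinumerous with a subset of `α`, whose order type is at most
  -- `α`.
  cover⇒card⊆ : ∀ {A α σ φ} → IsOrdinal α → Covers φ α A → ∣ A ∣≡ σ → σ ⊆ α
  cover⇒card⊆ {A} {α} {σ} {φ} oα cov ((oσ , σ-min) , A≈σ) = bound (subset-of-ordinal oα X⊆α)
    where
    ψ : V → V
    ψ z = ε λ β → β ∈ α × φ β ≡ z
    ψ-spec : ∀ {z} → z ∈ A → ψ z ∈ α × φ (ψ z) ≡ z
    ψ-spec {z} z∈ = ε-spec (λ β → β ∈ α × φ β ≡ z) (cov z∈)
    X : V
    X = repl A ψ
    X⊆α : X ⊆ α
    X⊆α β β∈ with ∈repl⁻ β∈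
    ... | z , z∈ , refl = proj₁ (ψ-spec z∈)
    A≃X : A ≃ X
    A≃X = injection-≃ ψ ∈repl⁺
      (λ p q e → trans (sym (proj₂ (ψ-spec p))) (trans (cong φ e) (proj₂ (ψ-spec q))))
      (λ β∈ → let (z , z∈ , e) = ∈repl⁻ β∈ in z , z∈ , sym e)
    bound : (∃ λ ρ → IsOrdinal ρ × ρ ⊆ α × ρ ≃ X) → σ ⊆ α
    bound (ρ , oρ , ρ⊆α , ρ≃X) with ordinal-⊆⊎∋ oσ oρ
    ... | inj₁ p = λ z → ρ⊆α z ∘ p z
    ... | inj₂ p = ⊥-elim (σ-min ρ p (≃⇒≈ (≃-trans ρ≃X (≃-trans (≃-sym A≃X) (≈⇒≃ A≈σ)))))

  -- The first elements of ω, and subsets coded by functions into `two`.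

  ∅∈ω : ∅ ∈ ω
  ∅∈ω = ∈sep⁺ (proj₁ (proj₂ infinity) ∅ λ _ → ∉∅) λ i ind → proj₁ ind ∅ λ _ → ∉∅

  succ-isSuccessor : ∀ x → IsSuccessor x (succ x)
  succ-isSuccessor x z = mk⇔ ∈-succ⁻ λ { (inj₁ p) → ∈∪ˡ p ; (inj₂ refl) → ∈∪ʳ ∈pairˡ }

  succ-∈ω : ∀ {x} → x ∈ ω → succ x ∈ ω
  succ-∈ω {x} x∈ = ∈sep⁺
    (proj₂ (proj₂ infinity) x (succ x) (proj₁ (∈sep⁻ x∈)) (succ-isSuccessor x))
    λ i ind → proj₂ ind x (succ x) (proj₂ (∈sep⁻ x∈) i ind) (succ-isSuccessor x)

  ∅≢succ : ∀ {x} → ∅ ≢ succ x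
  ∅≢succ {x} e = ∉∅ (subst (x ∈_) (sym e) (∈∪ʳ ∈pairˡ))

  -- Turns functions on a cardinal `N`, which are what 2^{<κ} counts, into subsets of an
  -- equinumerous `S`; the value `∅` marks membership.
  zeroSet : ∀ {N S} → N ≃ S → V → V
  zeroSet {S = S} b u = ｛ z ∶ S ∣ u · from b z ≡ ∅ ｝

  zeroSet-surjective : ∀ {N S c} (b : N ≃ S) → c ⊆ S → ∃ λ u → u ∈ (N ⇒ two) × zeroSet b u ≡ c
  zeroSet-surjective {N} {S} {c} b c⊆S = graph N χ , graph-⇒ χ-∈ , ext to′ from′
    where
    χ : V → V
    χ n = if to b n ∈ c then ∅ else succ ∅
    χ-∈ : ∀ {n} → n ∈ N → χ n ∈ two
    χ-∈ {n} _ = [ (λ p → subst (_∈ two) (sym (if-yes p)) ∅∈two)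
                , (λ ¬p → subst (_∈ two) (sym (if-no ¬p)) one∈two) ]′ (toSum em)
    value : ∀ {z} → z ∈ S → graph N χ · from b z ≡ χ (from b z)
    value z∈ = graph-· χ-∈ (from-∈ b z∈)
    to′ : zeroSet b (graph N χ) ⊆ c
    to′ z z∈ = let (z∈S , e) = ∈sep⁻ z∈ in byContradiction λ z∉ → ∅≢succ
      (trans (sym e) (trans (value z∈S) (if-no (z∉ ∘ subst (_∈ c) (to-from b z∈S)))))
    from′ : c ⊆ zeroSet b (graph N χ)
    from′ z z∈ = ∈sep⁺ (c⊆S z z∈)
      (trans (value (c⊆S z z∈)) (if-yes (subst (_∈ c) (sym (to-from b (c⊆S z z∈))) z∈)))

  -- Sets of size less than κ.

  record Hypotheses (κ : V) : Set ℓ where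
    field
      κ-regular : IsRegular κ
      ω∈κ       : ω ∈ κ
      2^<κ≡κ    : TwoToThe< κ ≡ κ

  module RegularCardinal (κ : V) (hypotheses : Hypotheses κ) where

    open Hypotheses hypotheses

    κ-ordinal : IsOrdinal κ
    κ-ordinal = proj₁ (proj₁ κ-regular)

    ∈κ-ordinal : ∀ {α} → α ∈ κ → IsOrdinal α
    ∈κ-ordinal = ∈-ordinal κ-ordinal

    ⊆-∈κ : ∀ {α β} → IsOrdinal α → α ⊆ β → β ∈ κ → α ∈ κ
    ⊆-∈κ oα = ⊆-∈⇒∈ oα κ-ordinal

    Small : V → Set ℓ
    Small A = ∣ A ∣< κ

    ordinal-cover⇒small : ∀ {A α φ} → α ∈ κ → Covers φ α A → Small A
    ordinal-cover⇒small {A} α∈ cov =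
      card A , ∣∣≡card A , ⊆-∈κ (card-ordinal A) (cover⇒card⊆ (∈κ-ordinal α∈) cov (∣∣≡card A)) α∈

    small-cover : ∀ {A B φ} → Small A → Covers φ A B → Small B
    small-cover {φ = φ} (σ , (_ , A≈σ) , σ∈) cov = ordinal-cover⇒small {φ = φ ∘ from e} σ∈ λ z∈ →
      let (y , y∈ , q) = cov z∈ in to e y , to-∈ e y∈ , trans (cong φ (from-to e y∈)) q
      where e = ≈⇒≃ A≈σ

    small-⊆ : ∀ {A B} → Small A → B ⊆ A → Small B
    small-⊆ sA B⊆A = small-cover {φ = id} sA λ z∈ → _ , B⊆A _ z∈ , refl

    small-repl : ∀ {A φ} → Small A → Small (repl A φ)
    small-repl {A} {φ} sA = small-cover {φ = φ} sA λ z∈ → let (y , y∈ , e) = ∈repl⁻ z∈ in y , y∈ , sym e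

    ∈κ-small : ∀ {α} → α ∈ κ → Small α
    ∈κ-small α∈ = ordinal-cover⇒small {φ = id} α∈ λ z∈ → _ , z∈ , refl

    small-pair : ∀ {x y} → Small ⟅ x , y ⟆
    -- ω serves as an index set already known to lie in `κ`; every nonzero index goes to `y`.
    small-pair {x} {y} = ordinal-cover⇒small {φ = φ} ω∈κ cov
      where
      φ : V → V
      φ n = if n ≡ ∅ then x else y
      cov : Covers φ ω ⟅ x , y ⟆
      cov z∈ = case ∈pair⁻ z∈ of λ
        { (inj₁ refl) → ∅ , ∅∈ω , if-yes refl
        ; (inj₂ refl) → succ ∅ , succ-∈ω ∅∈ω , if-no (∅≢succ ∘ sym) }

    opaque
      bound : V → V
      bound X = ε λ β → β ∈ κ × X ⊆ β

      -- An `X` without a strict bound would be cofinal of cardinality `σ ∈ κ`; regularity then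
      -- gives `κ ⊆ σ`, hence `σ ∈ σ`.
      small-bounded : ∀ {X} → X ⊆ κ → Small X → bound X ∈ κ × X ⊆ bound X
      small-bounded {X} X⊆κ (σ , ∣X∣ , σ∈) = ε-spec (λ β → β ∈ κ × X ⊆ β) (byContradiction λ unbounded →
        ∉-self (proj₂ (proj₂ (proj₂ (proj₂ κ-regular))) σ (proj₁ (proj₁ ∣X∣)) (cofinal unbounded) _ σ∈))
        where
        cofinal : ¬ (∃ λ β → β ∈ κ × X ⊆ β) →
                  ∃ λ X → X ⊆ κ × ∣ X ∣≡ σ × (∀ α → α ∈ κ → ∃ λ ξ → ξ ∈ X × α ⊆ ξ)
        cofinal unbounded = X , X⊆κ , ∣X∣ , λ α α∈ → byContradiction λ ¬q → unbounded (α , α∈ , λ ξ ξ∈ →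
          case ordinal-⊆⊎∋ (∈κ-ordinal α∈) (∈κ-ordinal (X⊆κ ξ ξ∈)) of λ
            { (inj₁ α⊆ξ) → ⊥-elim (¬q (ξ , ξ∈ , α⊆ξ)) ; (inj₂ ξ∈α) → ξ∈α })

    κ-not-small : ¬ Small κ
    κ-not-small s = let (b∈ , κ⊆b) = small-bounded (λ _ → id) s in ∉-self (κ⊆b _ b∈)

    ⋃-∈κ : ∀ {X} → X ⊆ κ → Small X → ⋃ X ∈ κ
    ⋃-∈κ X⊆κ s = let (b∈ , X⊆b) = small-bounded X⊆κ s in
      ⊆-∈κ (⋃-ordinal λ p → ∈κ-ordinal (X⊆κ _ p))
           (λ z z∈ → let (y , y∈ , z∈y) = ∈⋃⁻ z∈ in ordinal-trans (∈κ-ordinal b∈) (X⊆b y y∈) z∈y) b∈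

    ∪-∈κ : ∀ {α β} → α ∈ κ → β ∈ κ → α ∪ β ∈ κ
    ∪-∈κ α∈ β∈ = ⋃-∈κ (λ z z∈ → case ∈pair⁻ z∈ of λ { (inj₁ refl) → α∈ ; (inj₂ refl) → β∈ }) small-pair

    small-card : ∀ {A} → Small A → card A ∈ κ
    small-card {A} (σ , ∣A∣ , σ∈) = ⊆-∈κ (card-ordinal A) (cover⇒card⊆ (proj₁ (proj₁ ∣A∣)) cov (∣∣≡card A)) σ∈
      where
      cov : Covers (from (≈⇒≃ (proj₂ ∣A∣))) σ A
      cov z∈ = _ , to-∈ (≈⇒≃ (proj₂ ∣A∣)) z∈ , from-to (≈⇒≃ (proj₂ ∣A∣)) z∈

    -- Otherwise ⋃ X maps onto κ, although the image of each t ∈ X is bounded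
    -- and there are too few of these bounds to be cofinal.
    small-⋃ : ∀ {X} → Small X → (∀ {t} → t ∈ X → Small t) → Small (⋃ X)
    small-⋃ {X} sX st with em {card (⋃ X) ∈ κ}
    ... | yes p = card (⋃ X) , ∣∣≡card (⋃ X) , p
    ... | no ¬p = ⊥-elim (∉-2cycle b∈bound (proj₂ bounds-bounded _ (∈repl⁺ {φ = bound ∘ W} t∈)))
      where
      e = card≃ (⋃ X)
      κ⊆card : κ ⊆ card (⋃ X)
      κ⊆card = ∉⇒⊇ (card-ordinal (⋃ X)) κ-ordinal ¬p
      W : V → V
      W t = ｛ ξ ∶ κ ∣ to e ξ ∈ t ｝
      W-bounded : ∀ {t} → t ∈ X → bound (W t) ∈ κ × W t ⊆ bound (W t)
      W-bounded t∈ = small-bounded (λ _ → proj₁ ∘ ∈sep⁻) (small-cover {φ = from e} (st t∈) λ ξ∈ →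
        let (ξ∈κ , q) = ∈sep⁻ ξ∈ in _ , q , from-to e (κ⊆card _ ξ∈κ))
      bounds-bounded = small-bounded {repl X (bound ∘ W)}
        (λ z z∈ → let (t , t∈ , q) = ∈repl⁻ z∈ in subst (_∈ κ) (sym q) (proj₁ (W-bounded t∈)))
        (small-repl sX)
      b = bound (repl X (bound ∘ W))
      b∈κ : b ∈ κ
      b∈κ = proj₁ bounds-bounded
      preimage = ∈⋃⁻ (to-∈ e (κ⊆card b b∈κ))
      t = proj₁ preimage
      t∈ : t ∈ X
      t∈ = proj₁ (proj₂ preimage)
      b∈bound : b ∈ bound (W t)
      b∈bound = proj₂ (W-bounded t∈) b (∈sep⁺ b∈κ (proj₂ (proj₂ preimage)))

    small-∪ : ∀ {A B} → Small A → Small B → Small (A ∪ B)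
    small-∪ sA sB = small-⋃ small-pair λ p → case ∈pair⁻ p of λ { (inj₁ refl) → sA ; (inj₂ refl) → sB }

    small-⊗ : ∀ {A B} → Small A → Small B → Small (A ⊗ B)
    small-⊗ {A} {B} sA sB = small-⊆ {⋃ repl A row}
      (small-⋃ (small-repl sA) λ t∈ → let (x , _ , e) = ∈repl⁻ t∈ in subst Small (sym e) (small-repl sB))
      λ p p∈ → let (x , y , x∈ , y∈ , e) = ∈⊗⁻ p∈ in
        subst (_∈ ⋃ repl A row) (sym e) (∈⋃⁺ (∈repl⁺ x∈) (∈repl⁺ y∈))
      where
      row : V → V
      row x = ｛ ⟨ x , y ⟩ ∥ y ∶ B ｝

    -- If fewer than κ elements lie below each rank, the enumeration cannot reach κ.
    enumeration-length : ∀ {A rk} → (∀ {z} → z ∈ A → rk z ∈ κ) →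
      (∀ {α} → α ∈ κ → Small ｛ z ∶ A ∣ rk z ∈ α ｝) → Enumeration.ρ A rk ⊆ κ
    enumeration-length {A} {rk} rk∈ segments with ordinal-⊆⊎∋ (Enumeration.ρ-ordinal A rk) κ-ordinal
    ... | inj₁ p = p
    ... | inj₂ κ∈ρ = ⊥-elim (κ-not-small (small-cover {φ = from E.ρ≃A} (segments α∈) λ {ξ} ξ∈ →
            E.G ξ , ∈sep⁺ (E.G-∈ (ξ∈ρ ξ∈)) (rk-below ξ∈) , from-to E.ρ≃A (ξ∈ρ ξ∈)))
      where
      module E = Enumeration A rk
      ξ∈ρ : ∀ {ξ} → ξ ∈ κ → ξ ∈ E.ρ
      ξ∈ρ = ordinal-trans E.ρ-ordinal κ∈ρ
      -- Ranks do not drop along the enumeration, so the first κ elements all have rank at most `m`,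
      -- and any `α` above `m` captures them.
      m = rk (E.G κ)
      m∈ : m ∈ κ
      m∈ = rk∈ (E.G-∈ κ∈ρ)
      α = bound ⟅ m , m ⟆
      α-bound = small-bounded (λ z z∈ → subst (_∈ κ) (sym (∈singleton⁻ z∈)) m∈) small-pair
      α∈ : α ∈ κ
      α∈ = proj₁ α-bound
      rk-below : ∀ {ξ} → ξ ∈ κ → rk (E.G ξ) ∈ α
      rk-below ξ∈ = let orκ = ∈κ-ordinal (rk∈ (E.G-∈ (ξ∈ρ ξ∈))) in
        ⊆-∈⇒∈ orκ (∈κ-ordinal α∈) (∉⇒⊇ (∈κ-ordinal m∈) orκ (E.rk-G-monotone ξ∈ κ∈ρ))
          (proj₂ α-bound m ∈pairˡ)

    -- A pairing function on κ.

    private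
      maxRank : V → V
      maxRank p = fst p ∪ snd p
      module E = Enumeration (κ ⊗ κ) maxRank

    opaque
      unpair : V → V
      unpair = E.G

      -- Pairs are enumerated by their maximum, as in Gödel's ordering. Those of rank below `α` lie
      -- in the small set `α ⊗ α`, so the enumeration has length at most κ.
      unpair-surjective : ∀ {α β} → α ∈ κ → β ∈ κ → ∃ λ γ → γ ∈ κ × unpair γ ≡ ⟨ α , β ⟩
      unpair-surjective α∈ β∈ = let (γ , γ∈ , e) = E.G-surjective (∈⊗⁺ α∈ β∈) in γ , length γ γ∈ , e
        where
        coordinates : ∀ {p} → p ∈ κ ⊗ κ → p ≡ ⟨ fst p , snd p ⟩ × fst p ∈ κ × snd p ∈ κ
        coordinates p∈ with ∈⊗⁻ p∈
        ... | x , y , x∈ , y∈ , refl = cong₂ ⟨_,_⟩ (sym (fst-⟨,⟩ x y)) (sym (snd-⟨,⟩ x y))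
            , subst (_∈ κ) (sym (fst-⟨,⟩ x y)) x∈ , subst (_∈ κ) (sym (snd-⟨,⟩ x y)) y∈
        length : E.ρ ⊆ κ
        length = enumeration-length
          (λ p∈ → let (_ , x∈ , y∈) = coordinates p∈ in ∪-∈κ x∈ y∈)
          λ {α} α∈ → small-⊆ {α ⊗ α} (small-⊗ (∈κ-small α∈) (∈κ-small α∈)) λ p p∈ →
            let (p∈κ , rk∈) = ∈sep⁻ p∈
                (e , x∈ , y∈) = coordinates p∈κ
            in subst (_∈ α ⊗ α) (sym e) (∈⊗⁺
                 (⊆-∈⇒∈ (∈κ-ordinal x∈) (∈κ-ordinal α∈) (λ _ → ∈∪ˡ) rk∈)
                 (⊆-∈⇒∈ (∈κ-ordinal y∈) (∈κ-ordinal α∈) (λ _ → ∈∪ʳ) rk∈))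

-- Coding short bounded sequences by ordinals below κ.

module Codes {ℓ : Level} (em : ExcludedMiddle ℓ) (M : ZFC ℓ) (κ : ZFC.V M)
  (hypotheses : SetTheory.Hypotheses em M κ) where

  open ZFC M
  open Notions M
  open SetTheory em M
  open _≃_
  open RegularCardinal κ hypotheses
  open Hypotheses hypotheses

  -- An ordinal γ codes a function seq γ from len γ to height γ, as the subset of
  -- len γ ⊗ height γ with the given index.
  opaque
    len height index : V → V
    len γ = fst (unpair γ)
    height γ = fst (unpair (snd (unpair γ)))
    index γ = snd (unpair (snd (unpair γ)))

    unpair-triple : ∀ {γ γ′ η ζ ξ} → unpair γ ≡ ⟨ η , γ′ ⟩ → unpair γ′ ≡ ⟨ ζ , ξ ⟩ →
                    len γ ≡ η × height γ ≡ ζ × index γ ≡ ξ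
    unpair-triple {γ} {γ′} {η} {ζ} {ξ} e e′ = trans (cong fst e) (fst-⟨,⟩ η γ′)
      , trans (cong fst inner) (fst-⟨,⟩ ζ ξ) , trans (cong snd inner) (snd-⟨,⟩ ζ ξ)
      where
      inner : unpair (snd (unpair γ)) ≡ ⟨ ζ , ξ ⟩
      inner = trans (cong unpair (trans (cong snd e) (snd-⟨,⟩ η γ′))) e′

  triple-surjective : ∀ {η ζ ξ} → η ∈ κ → ζ ∈ κ → ξ ∈ κ →
                      ∃ λ γ → γ ∈ κ × len γ ≡ η × height γ ≡ ζ × index γ ≡ ξ
  triple-surjective η∈ ζ∈ ξ∈ =
    let (γ′ , γ′∈ , e′) = unpair-surjective ζ∈ ξ∈
        (γ , γ∈ , e) = unpair-surjective η∈ γ′∈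
    in γ , γ∈ , unpair-triple e e′

  opaque
    -- ξ ↦ 𝒟 S ξ runs through the zero sets of all functions from |S| to 2.
    𝒟 : V → V → V
    𝒟 S ξ = zeroSet (card≃ S) (to (card≃ (card S ⇒ two)) ξ)

    -- Here 2^{<κ} = κ enters: the cardinality of `card S ⇒ two` is at most κ, so every index below
    -- it is below κ.
    𝒟-surjective : ∀ {S c} → Small S → c ⊆ S → ∃ λ ξ → ξ ∈ κ × 𝒟 S ξ ≡ c
    𝒟-surjective {S} {c} sS c⊆S =
      let (u , u∈ , e) = zeroSet-surjective (card≃ S) c⊆S
          q = card≃ (card S ⇒ two)
      in from q u
       , proj₁ (proj₂ 2^<κ≡κ) (card S) _ (card-cardinal S) (small-card sS) (∣∣≡card _) _ (from-∈ q u∈)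
       , trans (cong (zeroSet (card≃ S)) (to-from q u∈)) e

  opaque
    -- If the decoded subset is not a function, the values are junk. This is harmless, since
    -- `Outpaces` constrains the values themselves.
    seq : V → V → V
    seq γ i = 𝒟 (len γ ⊗ height γ) (index γ) · i

    function-coded : ∀ {η ζ} {φ : V → V} → η ∈ κ → ζ ∈ κ → (∀ {i} → i ∈ η → φ i ∈ ζ) →
                     ∃ λ γ → γ ∈ κ × len γ ≡ η × height γ ≡ ζ × (∀ {i} → i ∈ η → seq γ i ≡ φ i)
    function-coded {η} {ζ} {φ} η∈ ζ∈ φ∈ =
      let (ξ , ξ∈ , e) = 𝒟-surjective {c = graph η φ} (small-⊗ (∈κ-small η∈) (∈κ-small ζ∈))
                           (λ p p∈ → ⇒-⊗ {η} {ζ} (graph-⇒ {φ = φ} φ∈) p∈)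
          (γ , γ∈ , len≡ , height≡ , index≡) = triple-surjective η∈ ζ∈ ξ∈
          coded = trans (cong₂ 𝒟 (cong₂ _⊗_ len≡ height≡) index≡) e
      in γ , γ∈ , len≡ , height≡ , λ {i} i∈ → trans (cong (_· i) coded) (graph-· {φ = φ} φ∈ i∈)

  -- Enlarging the height of a code does not change the function, so that
  -- every function has arbitrarily large codes.
  large-code : ∀ {η ζ β} {φ : V → V} → η ∈ κ → ζ ∈ κ → β ∈ κ → (∀ {i} → i ∈ η → φ i ∈ ζ) →
               ∃ λ γ → γ ∈ κ × β ⊆ γ × len γ ≡ η × (∀ {i} → i ∈ η → seq γ i ≡ φ i)
  large-code {η} {ζ} {β} {φ} η∈ ζ∈ β∈ φ∈ =
    let (γ , γ∈ , len≡ , height≡ , seq≡) = function-coded {φ = φ} η∈ ζ′∈ (λ i∈ → ∈∪ʳ {bound heights} (φ∈ i∈))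
    in γ , γ∈ , ∉⇒⊇ (∈κ-ordinal γ∈) (∈κ-ordinal β∈) (∉β height≡) , len≡ , seq≡
    where
    -- Heights used by ordinals below `β`. A height that contains their bound is not among them, so
    -- its code lies outside `β`. Intersecting with `κ` avoids having to show that every `height γ`
    -- is in `κ`.
    heights : V
    heights = repl β height ∩ κ
    heights-bounded : bound heights ∈ κ × heights ⊆ bound heights
    heights-bounded = small-bounded (λ z → proj₂ ∘ ∈sep⁻)
      (small-⊆ (small-repl (∈κ-small β∈)) (λ z → proj₁ ∘ ∈sep⁻))
    ζ′∈ : bound heights ∪ ζ ∈ κ
    ζ′∈ = ∪-∈κ (proj₁ heights-bounded) ζ∈
    ∉β : ∀ {γ} → height γ ≡ bound heights ∪ ζ → γ ∉ β
    ∉β e γ∈ = ∉-self (∈∪ˡ (proj₂ heights-bounded _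
      (∈sep⁺ (subst (_∈ repl β height) e (∈repl⁺ γ∈)) ζ′∈)))

  -- Codes outpacing a small family of functions.

  sup-before : V → V → V
  sup-before γ i = ⋃ repl i (seq γ)

  -- The argument ω of f is an arbitrary choice: one fixed value of f bounds the
  -- length from below.
  Outpaces : V → V → Set ℓ
  Outpaces γ f = f · ω ⊆ len γ × (∀ {i} → i ∈ len γ → f · sup-before γ i ∈ seq γ i × seq γ i ∈ γ)

  repl-⊆κ : ∀ {A} {φ : V → V} → (∀ {i} → i ∈ A → φ i ∈ κ) → repl A φ ⊆ κ
  repl-⊆κ φ∈ z z∈ = let (i , i∈ , e) = ∈repl⁻ z∈ in subst (_∈ κ) (sym e) (φ∈ i∈)

  module _ {x : V} (sx : Small x) (x⊆ : x ⊆ (κ ⇒ κ)) where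

    private
      value-bound : V → V
      value-bound z = bound ｛ f · z ∥ f ∶ x ｝

      value-bounds : ∀ {z} → z ∈ κ → value-bound z ∈ κ × ｛ f · z ∥ f ∶ x ｝ ⊆ value-bound z
      value-bounds z∈ = small-bounded (repl-⊆κ λ f∈ → ·-∈ (x⊆ _ f∈) z∈) (small-repl sx)

      value-∈bound : ∀ {f z} → f ∈ x → z ∈ κ → f · z ∈ value-bound z
      value-∈bound {z = z} f∈ z∈ = proj₂ (value-bounds z∈) _ (∈repl⁺ {φ = λ f → f · z} f∈)

      -- The sequence to be coded: each term strictly bounds the values, for all `f ∈ x`, at the
      -- supremum of the earlier terms.
      module R = OrdinalRecursion (λ s → value-bound (⋃ s))

      C-∈ : ∀ {α} → IsOrdinal α → α ∈ κ → R.G α ∈ κ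
      C-∈ = ordinal-induction (λ α → α ∈ κ → R.G α ∈ κ) λ oα IH α∈ →
        subst (_∈ κ) (sym (R.unfold oα)) (proj₁ (value-bounds
          (⋃-∈κ (repl-⊆κ λ i∈ → IH i∈ (ordinal-trans κ-ordinal α∈ i∈)) (small-repl (∈κ-small α∈)))))

      C-below : ∀ {α} → α ∈ κ → repl α R.G ⊆ κ
      C-below α∈ = repl-⊆κ λ i∈ → let i∈κ = ordinal-trans κ-ordinal α∈ i∈ in C-∈ (∈κ-ordinal i∈κ) i∈κ

      -- Agreement with `R.G` below `η` also identifies the suprema, so the recursion equation gives
      -- the growth condition. The length exceeds each f(ω) by the choice of `η`, and `ζ ⊆ γ` puts
      -- the terms below the code.
      C-outpaces : ∀ {γ η ζ} → η ∈ κ → η ≡ value-bound ω → repl η R.G ⊆ ζ → ζ ⊆ γ → len γ ≡ η →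
                   (∀ {i} → i ∈ η → seq γ i ≡ R.G i) → ∀ {f} → f ∈ x → Outpaces γ f
      C-outpaces {γ} {η} η∈ η≡ C⊆ζ ζ⊆γ len≡ seq≡ {f} f∈ =
        (λ z z∈ → subst (z ∈_) (sym len≡) (ordinal-trans (∈κ-ordinal η∈) fω∈η z∈)) , λ {i} i∈len →
          let i∈ = subst (i ∈_) len≡ i∈len
              i∈κ = ordinal-trans κ-ordinal η∈ i∈
              before = cong ⋃_ (repl-cong λ j∈ → seq≡ (ordinal-trans (∈κ-ordinal η∈) i∈ j∈))
          in subst₂ _∈_ (cong (f ·_) (sym before)) (sym (trans (seq≡ i∈) (R.unfold (∈κ-ordinal i∈κ))))
               (value-∈bound f∈ (⋃-∈κ (C-below i∈κ) (small-repl (∈κ-small i∈κ))))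
           , subst (_∈ γ) (sym (seq≡ i∈)) (ζ⊆γ _ (C⊆ζ _ (∈repl⁺ {φ = R.G} i∈)))
        where
        fω∈η : f · ω ∈ η
        fω∈η = subst (f · ω ∈_) (sym η≡) (value-∈bound f∈ ω∈κ)

      η : V
      η = value-bound ω
      η∈ : η ∈ κ
      η∈ = proj₁ (value-bounds ω∈κ)
      ζ : V
      ζ = bound (repl η R.G)
      ζ-bounds : ζ ∈ κ × repl η R.G ⊆ ζ
      ζ-bounds = small-bounded (C-below η∈) (small-repl (∈κ-small η∈))

    outpacing-code : ∀ {β} → β ∈ κ → ∃ λ γ → γ ∈ κ × β ⊆ γ × (∀ {f} → f ∈ x → Outpaces γ f)
    outpacing-code {β} β∈ = conclude (large-code {η} {ζ} {β ∪ ζ} {R.G} η∈ (proj₁ ζ-bounds)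
        (∪-∈κ β∈ (proj₁ ζ-bounds)) (λ i∈ → proj₂ ζ-bounds _ (∈repl⁺ {φ = R.G} i∈)))
      where
      conclude : (∃ λ γ → γ ∈ κ × β ∪ ζ ⊆ γ × len γ ≡ η × (∀ {i} → i ∈ η → seq γ i ≡ R.G i)) →
                 ∃ λ γ → γ ∈ κ × β ⊆ γ × (∀ {f} → f ∈ x → Outpaces γ f)
      conclude (γ , γ∈ , β∪ζ⊆γ , len≡ , seq≡) = γ , γ∈ , (λ z → β∪ζ⊆γ z ∘ ∈∪ˡ)
        , C-outpaces η∈ refl (proj₂ ζ-bounds) (λ z → β∪ζ⊆γ z ∘ ∈∪ʳ) len≡ seq≡

  -- The colouring of pairs of ordinals.

  IsColour : V → V → V → Set ℓ
  IsColour γ γ′ i = i ∈ κ × γ ∈ seq γ′ i × (∀ {j} → j ∈ i → γ ∉ seq γ′ j)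

  colour-unique : ∀ {γ γ′ i k} → IsColour γ γ′ i → IsColour γ γ′ k → i ≡ k
  colour-unique (i∈ , γ∈ , first) (k∈ , γ∈′ , first′) =
    case trichotomy (∈κ-ordinal i∈) (∈κ-ordinal k∈) of λ
      { (inj₁ p) → ⊥-elim (first′ p γ∈) ; (inj₂ (inj₁ e)) → e ; (inj₂ (inj₂ p)) → ⊥-elim (first p γ∈′) }

  opaque
    -- Pairs without such an index receive ω, merely a default element of `κ`.
    colour : V → V → V
    colour γ γ′ = if ∃ (IsColour γ γ′) then ε (IsColour γ γ′) else ω

    colour-≡ : ∀ {γ γ′ i} → IsColour γ γ′ i → colour γ γ′ ≡ i
    colour-≡ c = trans (if-yes (_ , c)) (colour-unique (ε-spec (IsColour _ _) (_ , c)) c)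

    colour-∈ : ∀ γ γ′ → colour γ γ′ ∈ κ
    colour-∈ γ γ′ = [ (λ p → subst (_∈ κ) (sym (colour-≡ (proj₂ p))) (proj₁ (proj₂ p)))
                    , (λ ¬p → subst (_∈ κ) (sym (if-no ¬p)) ω∈κ) ]′ (toSum (em {∃ (IsColour γ γ′)}))

  module _ {γ′ i x : V} {g : V → V} (γ′∈ : γ′ ∈ κ) (i∈ : i ∈ κ) (x⊆ : x ⊆ (κ ⇒ κ))
    (outpaces : ∀ {f} → f ∈ x → Outpaces γ′ f)
    (dominating : ∀ {α} → α ∈ κ → ∃ λ f → f ∈ x × g α ∈ f · α)
    (g-large : ∀ {α} → α ∈ κ → α ⊆ g α × i ⊆ g α × g α ∈ κ) where

    private
      -- Domination at ω gives `i ⊆ g ω ∈ f · ω ⊆ len γ′` for some `f ∈ x`. This is why `g` is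
      -- required to be at least `i` and the length at least f(ω).
      ≤i-∈len : ∀ {j} → j ∈ succ i → j ∈ len γ′
      ≤i-∈len j∈ =
        let (f , f∈ , g∈) = dominating ω∈κ
            (_ , i⊆g , _) = g-large ω∈κ
            fω∈ = ·-∈ (x⊆ f f∈) ω∈κ
            i∈f = ⊆-∈⇒∈ (∈κ-ordinal i∈) (∈κ-ordinal fω∈) i⊆g g∈
        in proj₁ (outpaces f∈) _ ([ ordinal-trans (∈κ-ordinal fω∈) i∈f
                                  , (λ e → subst (_∈ f · ω) (sym e) i∈f) ]′ (∈-succ⁻ j∈))

      seq-∈ : ∀ {j} → j ∈ succ i → seq γ′ j ∈ γ′
      seq-∈ j∈ = let (f , f∈ , _) = dominating ω∈κ in proj₂ (proj₂ (outpaces f∈) (≤i-∈len j∈))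

      i∈succ : i ∈ succ i
      i∈succ = ∈∪ʳ ∈pairˡ

      ζ∈ : sup-before γ′ i ∈ κ
      ζ∈ = ⋃-∈κ (repl-⊆κ λ j∈ → ordinal-trans κ-ordinal γ′∈ (seq-∈ (∈∪ˡ j∈))) (small-repl (∈κ-small i∈))

      gζ∈seq : g (sup-before γ′ i) ∈ seq γ′ i
      gζ∈seq = let (f , f∈ , p) = dominating ζ∈ in
        ordinal-trans (∈κ-ordinal (ordinal-trans κ-ordinal γ′∈ (seq-∈ i∈succ)))
          (proj₁ (proj₂ (outpaces f∈) (≤i-∈len i∈succ))) p

    colour-attained : ∃ λ α → α ∈ κ × g α ∈ γ′ × colour (g α) γ′ ≡ i
    colour-attained = sup-before γ′ i , ζ∈ , ordinal-trans (∈κ-ordinal γ′∈) (seq-∈ i∈succ) gζ∈seq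
      -- With ζ for `sup-before γ′ i`, an earlier term containing `g ζ` would put `g ζ` into ζ,
      -- hence into itself.
      , colour-≡ (i∈ , gζ∈seq , λ j∈ p → ∉-self (proj₁ (g-large ζ∈) _ (∈⋃⁺ (∈repl⁺ j∈) p)))

-- Cofinal subsets of P_κ(λ) and the induced colouring.

module Colouring {ℓ : Level} (em : ExcludedMiddle ℓ) (M : ZFC ℓ) (κ Λ : ZFC.V M)
  (hypotheses : SetTheory.Hypotheses em M κ)
  (Λ-ordinal : Notions.IsOrdinal M Λ) (κ∈Λ : ZFC._∈_ M κ Λ) where

  open ZFC M
  open Notions M
  open SetTheory em M
  open _≃_
  open RegularCardinal κ hypotheses
  open Codes em M κ hypotheses

  κ⊆Λ : κ ⊆ Λ
  κ⊆Λ = proj₁ Λ-ordinal κ κ∈Λ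

  ∈P⁺ : ∀ {a A} → a ⊆ A → Small a → a ∈ P κ A
  ∈P⁺ a⊆ sa = ∈sep⁺ (∈𝒫⁺ a⊆) sa

  ∈P-⊆ : ∀ {a A} → a ∈ P κ A → a ⊆ A
  ∈P-⊆ a∈ = ∈𝒫⁻ (proj₁ (∈sep⁻ a∈))

  ∈P-small : ∀ {a A} → a ∈ P κ A → Small a
  ∈P-small a∈ = proj₂ (∈sep⁻ a∈)

  -- The working form of membership in `I⁺ κ Λ`; the two translations follow.
  Cofinal : V → Set ℓ
  Cofinal A = ∀ {a} → a ∈ P κ Λ → ∃ λ b → b ∈ A × a ⊆ b

  cone : V → V
  cone a = ｛ b ∶ P κ Λ ∣ a ⊆ b ｝

  cofinal⇒I⁺ : ∀ {A} → A ⊆ P κ Λ → Cofinal A → A ∈ I⁺ κ Λ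
  cofinal⇒I⁺ {A} A⊆ cofinal = ∈sep⁺ (∈𝒫⁺ A⊆) A∉I
    where
    A∉I : A ∉ I κ Λ
    A∉I A∈I = let (_ , a , a∈ , e) = ∈sep⁻ A∈I
                  (b , b∈ , a⊆b) = cofinal a∈
              in ∉∅ (subst (b ∈_) e (∈sep⁺ b∈ (∈sep⁺ (A⊆ b b∈) a⊆b)))

  I⁺⇒cofinal : ∀ {A} → A ∈ I⁺ κ Λ → Cofinal A
  I⁺⇒cofinal {A} A∈ {a} a∈ = byContradiction λ ¬p → proj₂ (∈sep⁻ A∈) (A∈I ¬p)
    where
    A∈I : ¬ (∃ λ b → b ∈ A × a ⊆ b) → A ∈ I κ Λ
    A∈I ¬p = ∈sep⁺ (proj₁ (∈sep⁻ A∈)) (a , a∈ , ext empty λ b b∈ → ⊥-elim (∉∅ b∈))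
      where
      empty : A ∩ cone a ⊆ ∅
      empty b b∈ = let (b∈A , b∈cone) = ∈sep⁻ b∈ in ⊥-elim (¬p (b , b∈A , proj₂ (∈sep⁻ b∈cone)))

  sup : V → V
  sup a = ⋃ (a ∩ κ)

  ∩κ⊆κ : ∀ {a} → a ∩ κ ⊆ κ
  ∩κ⊆κ z z∈ = proj₂ (∈sep⁻ z∈)

  small-∩κ : ∀ {a} → Small a → Small (a ∩ κ)
  small-∩κ sa = small-⊆ sa λ z z∈ → proj₁ (∈sep⁻ z∈)

  sup-∈κ : ∀ {a} → Small a → sup a ∈ κ
  sup-∈κ sa = ⋃-∈κ ∩κ⊆κ (small-∩κ sa)

  ⊆-sup : ∀ {a γ} → γ ∈ a → γ ∈ κ → γ ⊆ sup a
  ⊆-sup γ∈a γ∈κ z = ∈⋃⁺ (∈sep⁺ γ∈a γ∈κ)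

  -- After the adjunction γ is the greatest ordinal below κ in the set. This allows `sup` to be
  -- prescribed when `a` is enlarged.
  sup-adjoin : ∀ {a γ} → γ ∈ κ → a ∩ κ ⊆ γ → sup (a ∪ ⟅ γ , γ ⟆) ≡ γ
  sup-adjoin {a} {γ} γ∈κ a⊆γ = ext below (⊆-sup (∈∪ʳ ∈pairˡ) γ∈κ)
    where
    member : ∀ {y z} → y ∈ κ → z ∈ y → y ∈ a ⊎ y ∈ ⟅ γ , γ ⟆ → z ∈ γ
    member y∈κ z∈y (inj₁ y∈a) = ordinal-trans (∈κ-ordinal γ∈κ) (a⊆γ _ (∈sep⁺ y∈a y∈κ)) z∈y
    member {z = z} y∈κ z∈y (inj₂ y∈) = subst (z ∈_) (∈singleton⁻ y∈) z∈y
    below : sup (a ∪ ⟅ γ , γ ⟆) ⊆ γ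
    below z z∈ = let (y , y∈ , z∈y) = ∈⋃⁻ z∈
                     (y∈∪ , y∈κ) = ∈sep⁻ y∈
                 in member y∈κ z∈y (∈∪⁻ y∈∪)

  pairColour : V → V
  pairColour p = colour (fst p) (snd p)

  pairColour-≡ : ∀ {γ γ′ i} → colour γ γ′ ≡ i → pairColour ⟨ γ , γ′ ⟩ ≡ i
  pairColour-≡ {γ} {γ′} e = trans (cong₂ colour (fst-⟨,⟩ γ γ′) (snd-⟨,⟩ γ γ′)) e

  F : V
  F = graph (Pairs κ (P κ Λ)) pairColour

  F-∈ : F ∈ (Pairs κ (P κ Λ) ⇒ κ)
  F-∈ = graph-⇒ {φ = pairColour} λ _ → colour-∈ _ _

  ∈Pairs⁺ : ∀ {A a b} → a ∈ A → b ∈ A → sup a ∈ sup b → ⟨ sup a , sup b ⟩ ∈ Pairs κ A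
  ∈Pairs⁺ a∈ b∈ a<b = ∈sep⁺ (∈⊗⁺ (∈repl⁺ {φ = sup} a∈) (∈repl⁺ {φ = sup} b∈)) (_ , _ , a∈ , b∈ , a<b , refl)

  image-F-⊆κ : ∀ {Y} → image F Y ⊆ κ
  image-F-⊆κ y y∈ = let (_ , _ , p) = ∈image⁻ y∈ in proj₂ (⟨,⟩∈⊗⁻ (⇒-⊗ F-∈ p))

  colour-∈image : ∀ {B a b i} → B ⊆ P κ Λ → a ∈ B → b ∈ B → sup a ∈ sup b → colour (sup a) (sup b) ≡ i →
                  i ∈ image F (Pairs κ B)
  colour-∈image B⊆ a∈ b∈ a<b e = ∈image⁺ (∈Pairs⁺ a∈ b∈ a<b)
    (subst (λ i → ⟨ _ , i ⟩ ∈ F) (pairColour-≡ e)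
      (∈repl⁺ {φ = λ p → ⟨ p , pairColour p ⟩} (∈Pairs⁺ (B⊆ _ a∈) (B⊆ _ b∈) a<b)))

  -- A cofinal set all of whose cofinal subsets receive every colour.

  module _ {X T : V} (e : X ≃ T) (X⊆ : X ⊆ (κ ⇒ κ))
    (X-dominates : ∀ g → g ∈ (κ ⇒ κ) → ∃ λ x → x ∈ P κ X ×
                     (∀ α → α ∈ κ → g · α ∈ ⋃ ｛ f · α ∥ f ∶ x ｝))
    (T⊆ : T ⊆ P κ Λ) (T-sparse : ∀ a → a ∈ P κ Λ → Small (T ∩ 𝒫 a)) where

    -- `from e t` is the member of the dominating family indexed by `t`. The strict inequality
    -- exempts those `t` that contain the ordinal adjoined in `adjoin-good`.
    Good : V → Set ℓ
    Good a = ∀ t → t ∈ T → t ⊆ a → sup t ∈ sup a → Outpaces (sup a) (from e t)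

    A : V
    A = ｛ a ∶ P κ Λ ∣ Good a ｝

    -- Adjoining γ to a brings in only sets t with γ ∈ t, hence with sup t ≥ γ.
    adjoin-good : ∀ {a γ} → γ ∈ κ → a ∩ κ ⊆ γ → (∀ {t} → t ∈ T → t ⊆ a → Outpaces γ (from e t)) →
                  Good (a ∪ ⟅ γ , γ ⟆)
    adjoin-good {a} {γ} γ∈κ a⊆γ outpaces t t∈ t⊆ t<a =
      subst (λ s → Outpaces s (from e t)) (sym sup≡) (outpaces t∈ λ z z∈ →
        [ id , (λ z∈γ → ⊥-elim (γ∉t (subst (_∈ t) (∈singleton⁻ z∈γ) z∈))) ]′ (∈∪⁻ (t⊆ z z∈)))
      where
      sup≡ : sup (a ∪ ⟅ γ , γ ⟆) ≡ γ
      sup≡ = sup-adjoin γ∈κ a⊆γ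
      γ∉t : γ ∉ t
      γ∉t γ∈t = ∉-self (⊆-sup γ∈t γ∈κ _ (subst (sup t ∈_) sup≡ t<a))

    -- Sparseness leaves fewer than κ functions indexed by subsets of `a`, so a single code beyond
    -- `a ∩ κ` outpaces them all; that code is adjoined to `a`.
    A-cofinal : Cofinal A
    A-cofinal {a} a∈ = conclude (outpacing-code {x} (small-repl (T-sparse a a∈)) x⊆ (proj₁ a-bound))
      where
      x : V
      x = repl (T ∩ 𝒫 a) (from e)
      x⊆ : x ⊆ (κ ⇒ κ)
      x⊆ f f∈ = let (t , t∈ , q) = ∈repl⁻ f∈ in
        subst (_∈ (κ ⇒ κ)) (sym q) (X⊆ _ (from-∈ e (proj₁ (∈sep⁻ t∈))))
      a-bound : bound (a ∩ κ) ∈ κ × a ∩ κ ⊆ bound (a ∩ κ)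
      a-bound = small-bounded ∩κ⊆κ (small-∩κ (∈P-small a∈))
      conclude : (∃ λ γ → γ ∈ κ × bound (a ∩ κ) ⊆ γ × (∀ {f} → f ∈ x → Outpaces γ f)) →
                 ∃ λ b → b ∈ A × a ⊆ b
      conclude (γ , γ∈ , bound⊆γ , outpaces) = a ∪ ⟅ γ , γ ⟆
        , ∈sep⁺ (∈P⁺ (λ z z∈ → [ ∈P-⊆ a∈ z , (λ z∈γ → κ⊆Λ z (subst (_∈ κ) (sym (∈singleton⁻ z∈γ)) γ∈)) ]′ (∈∪⁻ z∈))
                     (small-∪ (∈P-small a∈) small-pair))
            (adjoin-good γ∈ (λ z z∈ → bound⊆γ z (proj₂ a-bound z z∈))
              λ t∈ t⊆a → outpaces (∈repl⁺ {φ = from e} (∈sep⁺ t∈ (∈𝒫⁺ t⊆a))))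
        , λ z → ∈∪ˡ

    module _ {B : V} (B⊆A : B ⊆ A) (B-cofinal : Cofinal B) where

      private
        B⊆P : B ⊆ P κ Λ
        B⊆P b b∈ = proj₁ (∈sep⁻ (B⊆A b b∈))

        above : V → V
        above t = bound ⟅ sup t , sup t ⟆

        above-spec : ∀ {t} → t ∈ T → above t ∈ κ × sup t ∈ above t
        above-spec {t} t∈ = let (b∈ , ⊆b) = small-bounded
                                  (λ z z∈ → subst (_∈ κ) (sym (∈singleton⁻ z∈)) (sup-∈κ (∈P-small (T⊆ t t∈))))
                                  small-pair
                            in b∈ , ⊆b _ ∈pairˡ

        -- What a member of `B` must contain for `Good` to apply to `f`: the index set of `f`, and
        -- an ordinal forcing the strict inequality of suprema.
        seed : V → V
        seed f = to e f ∪ ⟅ above (to e f) , above (to e f) ⟆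

        seed-small : ∀ {f} → f ∈ X → Small (seed f)
        seed-small f∈ = small-∪ (∈P-small (T⊆ _ (to-∈ e f∈))) small-pair

        seed-⊆ : ∀ {f} → f ∈ X → seed f ⊆ Λ
        seed-⊆ f∈ z z∈ = [ ∈P-⊆ (T⊆ _ (to-∈ e f∈)) z
                         , (λ q → κ⊆Λ z (subst (_∈ κ) (sym (∈singleton⁻ q)) (proj₁ (above-spec (to-∈ e f∈))))) ]′
                         (∈∪⁻ z∈)

        seed-outpaces : ∀ {f b} → f ∈ X → b ∈ B → seed f ⊆ b → Outpaces (sup b) f
        seed-outpaces {f} {b} f∈ b∈ seed⊆ = subst (Outpaces (sup b)) (from-to e f∈)
          (proj₂ (∈sep⁻ (B⊆A b b∈)) (to e f) (to-∈ e f∈) (λ z z∈ → seed⊆ z (∈∪ˡ z∈))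
            (⊆-sup (seed⊆ _ (∈∪ʳ ∈pairˡ)) (proj₁ (above-spec (to-∈ e f∈))) _ (proj₂ (above-spec (to-∈ e f∈)))))

        -- Fewer than κ small seeds have a small union, which some member of the cofinal `B`
        -- contains.
        outpacing-member : ∀ {x} → x ∈ P κ X → ∃ λ b → b ∈ B × (∀ {f} → f ∈ x → Outpaces (sup b) f)
        outpacing-member {x} x∈ = conclude (B-cofinal (∈P⁺ {⋃ repl x seed} seeds⊆ seeds-small))
          where
          seeds⊆ : ⋃ repl x seed ⊆ Λ
          seeds⊆ z z∈ = let (y , y∈ , z∈y) = ∈⋃⁻ z∈
                            (f , f∈ , q) = ∈repl⁻ y∈
                        in seed-⊆ (∈P-⊆ x∈ f f∈) z (subst (z ∈_) q z∈y)
          seeds-small : Small (⋃ repl x seed)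
          seeds-small = small-⋃ (small-repl (∈P-small x∈)) λ y∈ →
            let (f , f∈ , q) = ∈repl⁻ y∈ in subst Small (sym q) (seed-small (∈P-⊆ x∈ f f∈))
          conclude : (∃ λ b → b ∈ B × ⋃ repl x seed ⊆ b) →
                     ∃ λ b → b ∈ B × (∀ {f} → f ∈ x → Outpaces (sup b) f)
          conclude (b , b∈ , ⊆b) = b , b∈ , λ {f} f∈ →
            seed-outpaces (∈P-⊆ x∈ f f∈) b∈ λ z z∈ → ⊆b z (∈⋃⁺ (∈repl⁺ {φ = seed} f∈) z∈)

        module _ {i : V} (i∈ : i ∈ κ) where

          member : V → V
          member α = ε λ b → b ∈ B × ⟅ α , i ⟆ ⊆ b

          member-spec : ∀ {α} → α ∈ κ → member α ∈ B × ⟅ α , i ⟆ ⊆ member α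
          member-spec {α} α∈ = ε-spec (λ b → b ∈ B × ⟅ α , i ⟆ ⊆ b) (B-cofinal (∈P⁺
            (λ z z∈ → κ⊆Λ z ([ (λ q → subst (_∈ κ) (sym q) α∈) , (λ q → subst (_∈ κ) (sym q) i∈) ]′ (∈pair⁻ z∈)))
            small-pair))

          -- The values are suprema of members of `B`, so the ordinal supplied by `colour-attained`
          -- is already the first coordinate of a pair from `B`.
          g : V → V
          g α = sup (member α)

          g-∈ : ∀ {α} → α ∈ κ → g α ∈ κ
          g-∈ α∈ = sup-∈κ (∈P-small (B⊆P _ (proj₁ (member-spec α∈))))

          g-large : ∀ {α} → α ∈ κ → α ⊆ g α × i ⊆ g α × g α ∈ κ
          g-large α∈ = let ⊆member = proj₂ (member-spec α∈) in
            ⊆-sup (⊆member _ ∈pairˡ) α∈ , ⊆-sup (⊆member _ ∈pairʳ) i∈ , g-∈ α∈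

          dominating : ∀ {x} → (∀ α → α ∈ κ → graph κ g · α ∈ ⋃ ｛ f · α ∥ f ∶ x ｝) →
                       ∀ {α} → α ∈ κ → ∃ λ f → f ∈ x × g α ∈ f · α
          dominating dom {α} α∈ =
            let (y , y∈ , p) = ∈⋃⁻ (dom α α∈)
                (f , f∈ , q) = ∈repl⁻ y∈
            in f , f∈ , subst₂ _∈_ (graph-· {φ = g} g-∈ α∈) q p

          attained : (∃ λ x → x ∈ P κ X × (∀ α → α ∈ κ → graph κ g · α ∈ ⋃ ｛ f · α ∥ f ∶ x ｝)) →
                     i ∈ image F (Pairs κ B)
          attained (x , x∈ , dom) = conclude (outpacing-member x∈)
            where
            finish : ∀ {b} → b ∈ B → (∃ λ α → α ∈ κ × g α ∈ sup b × colour (g α) (sup b) ≡ i) →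
                     i ∈ image F (Pairs κ B)
            finish b∈ (α , α∈ , g<b , q) = colour-∈image B⊆P (proj₁ (member-spec α∈)) b∈ g<b q
            conclude : (∃ λ b → b ∈ B × (∀ {f} → f ∈ x → Outpaces (sup b) f)) → i ∈ image F (Pairs κ B)
            conclude (b , b∈ , outpaces) = finish b∈ (colour-attained {g = g} (sup-∈κ (∈P-small (B⊆P b b∈))) i∈
              (λ f f∈ → X⊆ f (∈P-⊆ x∈ f f∈)) outpaces (dominating dom) g-large)

      all-colours : image F (Pairs κ B) ≡ κ
      all-colours = ext image-F-⊆κ λ i i∈ → attained i∈ (X-dominates (graph κ (g i∈)) (graph-⇒ {φ = g i∈} (g-∈ i∈)))

    ¬Arrow : ¬ Arrow κ Λ κ
    ¬Arrow arrow = conclude (arrow F F-∈ A (cofinal⇒I⁺ (λ a → proj₁ ∘ ∈sep⁻) A-cofinal))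
      where
      conclude : (∃ λ B → B ∈ I⁺ κ Λ ∩ 𝒫 A × image F (Pairs κ B) ≢ κ) → ⊥
      conclude (B , B∈ , ≢κ) = let (B∈I⁺ , B∈𝒫) = ∈sep⁻ B∈ in
        ≢κ (all-colours (∈𝒫⁻ B∈𝒫) (I⁺⇒cofinal B∈I⁺))

  -- Singletons as a sparse family.

  module _ {δ : V} (δ⊆Λ : δ ⊆ Λ) where

    singletons : V
    singletons = ｛ ⟅ ξ , ξ ⟆ ∥ ξ ∶ δ ｝

    ≃singletons : δ ≃ singletons
    ≃singletons = injection-≃ (λ ξ → ⟅ ξ , ξ ⟆) ∈repl⁺ (λ _ _ → singleton-injective)
      λ t∈ → let (ξ , ξ∈ , q) = ∈repl⁻ t∈ in ξ , ξ∈ , sym q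

    singletons-⊆P : singletons ⊆ P κ Λ
    singletons-⊆P t t∈ =
      let (ξ , ξ∈ , q) = ∈repl⁻ t∈ in
      subst (_∈ P κ Λ) (sym q) (∈P⁺ (λ z z∈ → subst (_∈ Λ) (sym (∈singleton⁻ z∈)) (δ⊆Λ ξ ξ∈)) small-pair)

    -- The singletons inside `a` are indexed by elements of `a`, and `a` is small.
    singletons-sparse : ∀ a → a ∈ P κ Λ → Small (singletons ∩ 𝒫 a)
    singletons-sparse a a∈ = small-cover {φ = λ ξ → ⟅ ξ , ξ ⟆} (∈P-small a∈) λ t∈ →
      let (t∈S , t∈𝒫) = ∈sep⁻ t∈
          (ξ , _ , q) = ∈repl⁻ t∈S
      in ξ , ∈𝒫⁻ t∈𝒫 ξ (subst (ξ ∈_) (sym q) ∈pairˡ) , sym q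

theorem15p2 : ∀ {ℓ} → ExcludedMiddle ℓ → (M : ZFC ℓ) →
    let open ZFC M
        open Notions M
    in
    ∀ (κ Λ δ : V) →
    IsRegular κ → ω ∈ κ →
    IsCardinal Λ → κ ∈ Λ →
    IsLimitCardinal κ → TwoToThe< κ ≡ κ →
    IsDBar κ δ → (δ ∈ Λ ⊎ 𝒦 κ Λ δ) →
    ¬ Arrow κ Λ κ
theorem15p2 em M κ Λ δ κ-regular ω∈κ Λ-cardinal κ∈Λ _ 2^<κ≡κ
  (_ , (X , X⊆ , (_ , X≈δ) , X-dominates) , _) =
  -- If λ exceeds 𝔡̄_κ, the singletons of the ordinals below `δ` serve as `T`.
  [ (λ δ∈Λ → let δ⊆Λ = proj₁ (proj₁ Λ-cardinal) δ δ∈Λ in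
      ¬Arrow (≃-trans (≈⇒≃ X≈δ) (≃singletons δ⊆Λ)) X⊆ X-dominates (singletons-⊆P δ⊆Λ) (singletons-sparse δ⊆Λ))
  -- Otherwise `T` is the witness to 𝔡̄_κ ∈ 𝒦(κ, λ), matched with the dominating family through `δ`.
  , (λ { (_ , _ , T , T⊆ , (_ , T≈δ) , T-sparse) →
      ¬Arrow (≃-trans (≈⇒≃ X≈δ) (≃-sym (≈⇒≃ T≈δ))) X⊆ X-dominates T⊆ T-sparse }) ]′
  where
  open SetTheory em M
  hypotheses : Hypotheses κ
  hypotheses = record { κ-regular = κ-regular ; ω∈κ = ω∈κ ; 2^<κ≡κ = 2^<κ≡κ }
  open Colouring em M κ Λ hypotheses (proj₁ Λ-cardinal) κ∈Λ
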